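{- For $\omega\in\mathfrak{B}_n$ chosen uniformly at random, with high probability $\alpha(\omega)=\Theta(n^3)$ and $\beta(\omega)=\Theta(n^3)$; that is, for every sequence $h(n)\to\infty$ of positive reals, $$\mathbb{P}\left(\frac{n^3}{h(n)}\le\alpha(\omega)\le h(n)\,n^3\ \text{ and }\ \frac{n^3}{h(n)}\le\beta(\omega)\le h(n)\,n^3\right)\to1\qquad(n\to\infty).$$
   Context: $\mathfrak{S}_n$ is the set of permutations of $[n]=\{1,\dots,n\}$, in one-line notation. A reduction of $\omega\in\mathfrak{S}_n$ interchanges $\omega(i)$ and $\omega(j)$ for some $i<j$ with $\omega(i)>\omega(j)$. Bruhat order: $\pi\le\sigma$ if $\pi$ is obtained from $\sigma$ by a (possibly empty) sequence of reductions. $\mathfrak{B}_n\subseteq\mathfrak{S}_n$ is the set of bigrassmannian permutations, i.e. those $\omega$ such that both $\omega$ and $\omega^{ -1}$ have exactly one descent; equivalently $\omega=1\cdots a\,(b+1)\cdots c\,(a+1)\cdots b\,(c+1)\cdots n$ for some $0\le a<b<c\le n$. For $\omega\in\mathfrak{B}_n$, $\beta(\omega)$ is the number of $\pi\in\mathfrak{B}_n$ with $\pi\le\omega$, and $\alpha(\omega)$ is the number of $\tau\in\mathfrak{B}_n$ with $\omega\le\tau$. -}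

module Defs where

open import Data.Fin.Base as Fin using (Fin; zero; suc; toℕ)
import Data.Fin.Induction as Finᵢ
import Data.Fin.Properties as Finₚ
open import Data.Fin.Permutation as Perm
  using (Permutation′; _⟨$⟩ʳ_; _≈_; flip; transpose; insert; remove; _∘ₚ_)
import Data.Integer.Base as ℤ
open import Data.List.Base using (List; []; _∷_; length; filter; allFin; cartesianProductWith)
import Data.List.Membership.Setoid as Membership
import Data.List.Membership.Setoid.Properties as Membershipₚ
open import Data.List.Membership.Propositional.Properties using (∈-allFin)
open import Data.List.Relation.Binary.Sublist.Propositional using (_⊆_)
open import Data.List.Relation.Unary.All using (All; []; _∷_)
open import Data.List.Relation.Unary.AllPairs using ([]; _∷_)
open import Data.List.Relation.Unary.Any using (here)
import Data.List.Relation.Unary.Unique.Setoid as Unique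
import Data.List.Relation.Unary.Unique.Setoid.Properties as Uniqueₚ
open import Data.List.Relation.Unary.Unique.Propositional.Properties using (allFin⁺)
open import Data.Nat.Base as ℕ using (ℕ; zero; suc)
import Data.Nat.Properties as ℕₚ
open import Data.Product.Base using (∃; ∃-syntax; _×_; _,_; proj₁; proj₂)
open import Data.Rational.Base as ℚ
  using (ℚ; 0ℚ; 1ℚ; _<_; _≤_; _*_)
open import Data.Rational.Literals using (fromℤ)
import Data.Rational.Properties as ℚₚ
open import Data.Sum.Base using (_⊎_; inj₁; inj₂)
open import Data.Vec.Base using (tabulate)
open import Data.Vec.Relation.Binary.Lex.Strict as Lex using (Lex-<; this; next)
open import Function.Base using (_∘_)
open import Induction.WellFounded using (Acc; acc; WellFounded)
open import Level using (0ℓ)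
open import Relation.Binary.Bundles using (Setoid)
open import Relation.Binary.Definitions using (tri<; tri≈; tri>)
open import Relation.Binary.PropositionalEquality
open import Relation.Nullary.Decidable using (Dec; yes; no; _×-dec_; map′; dec-true; dec-false)
open import Relation.Nullary.Negation using (¬_; contradiction)
open import Relation.Unary using (Pred; Decidable)

------------------------------------------------------------------------
-- Permutations

-- [n] is represented by Fin n, so positions and values are shifted by
-- one.  ω is in one-line notation ω ⟨$⟩ʳ 0 , ω ⟨$⟩ʳ 1 , …, and ω⁻¹ is
-- flip ω.  Permutations are compared by _≈_ (pointwise equality).

𝔖 : ℕ → Set
𝔖 = Permutation′

𝔖-setoid : ℕ → Setoid 0ℓ 0ℓ
𝔖-setoid n = record
  { Carrier = 𝔖 n
  ; _≈_ = _≈_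
  ; isEquivalence = record
    { refl  = λ _ → refl
    ; sym   = λ p i → sym (p i)
    ; trans = λ p q i → trans (p i) (q i)
    }
  }

_≈?_ : ∀ {n} (π σ : 𝔖 n) → Dec (π ≈ σ)
π ≈? σ = Finₚ.all? λ i → (π ⟨$⟩ʳ i) Finₚ.≟ (σ ⟨$⟩ʳ i)

-- insert zero i π sends zero to i and the other positions, in order,
-- to the other values following the pattern of π.
permutations : ∀ n → List (𝔖 n)
permutations zero    = Perm.id ∷ []
permutations (suc n) = cartesianProductWith (insert zero) (allFin (suc n)) (permutations n)

private
  insert₀-inj : ∀ {n} {i j : Fin (suc n)} {π σ : 𝔖 n} →
                insert zero i π ≈ insert zero j σ → i ≡ j × π ≈ σ
  insert₀-inj {i = i} {π = π} {σ} eq with eq zero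
  ... | refl = refl , λ k → Finₚ.punchIn-injective i _ _ (begin
      Fin.punchIn i (π ⟨$⟩ʳ k)     ≡⟨ Perm.insert-punchIn zero i π k ⟨
      insert zero i π ⟨$⟩ʳ suc k   ≡⟨ eq (suc k) ⟩
      insert zero i σ ⟨$⟩ʳ suc k   ≡⟨ Perm.insert-punchIn zero i σ k ⟩
      Fin.punchIn i (σ ⟨$⟩ʳ k)     ∎)
    where open ≡-Reasoning

  insert₀-cong : ∀ {n} {i j : Fin (suc n)} {π σ : 𝔖 n} →
                 i ≡ j → π ≈ σ → insert zero i π ≈ insert zero j σ
  insert₀-cong refl eq zero = refl
  insert₀-cong {i = i} {π = π} {σ} refl eq (suc k) = begin
      insert zero i π ⟨$⟩ʳ suc k   ≡⟨ Perm.insert-punchIn zero i π k ⟩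
      Fin.punchIn i (π ⟨$⟩ʳ k)     ≡⟨ cong (Fin.punchIn i) (eq k) ⟩
      Fin.punchIn i (σ ⟨$⟩ʳ k)     ≡⟨ Perm.insert-punchIn zero i σ k ⟨
      insert zero i σ ⟨$⟩ʳ suc k   ∎
    where open ≡-Reasoning

permutations-complete : ∀ {n} (π : 𝔖 n) → Membership._∈_ (𝔖-setoid n) π (permutations n)
permutations-complete {zero}  π = here λ ()
permutations-complete {suc n} π =
  Membershipₚ.∈-resp-≈ (𝔖-setoid (suc n)) {permutations (suc n)}
    {insert zero (π ⟨$⟩ʳ zero) (remove zero π)} {π}
    (Perm.insert-remove zero π)
    (Membershipₚ.∈-cartesianProductWith⁺ (setoid _) (𝔖-setoid n) (𝔖-setoid (suc n))
      (λ {i} {j} {π} {σ} → insert₀-cong {π = π} {σ})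
      (∈-allFin (π ⟨$⟩ʳ zero)) (permutations-complete (remove zero π)))

permutations-unique : ∀ n → Unique.Unique (𝔖-setoid n) (permutations n)
permutations-unique zero    = [] ∷ []
permutations-unique (suc n) =
  Uniqueₚ.cartesianProductWith⁺ (setoid _) (𝔖-setoid n) (𝔖-setoid (suc n))
    (insert zero) (λ {i} {j} {π} {σ} → insert₀-inj {i = i} {j} {π} {σ})
    (allFin⁺ (suc n)) (permutations-unique n)

------------------------------------------------------------------------
-- Bruhat order

-- transpose i j ∘ₚ σ acts by transpose i j first: it is σ with the
-- entries in positions i and j interchanged.
interchange : ∀ {n} → Fin n → Fin n → 𝔖 n → 𝔖 n
interchange i j σ = transpose i j ∘ₚ σ

infix 4 _≤ᴮ_

data _≤ᴮ_ {n} (π : 𝔖 n) : 𝔖 n → Set where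
  done   : ∀ {σ} → π ≈ σ → π ≤ᴮ σ
  reduce : ∀ {σ} (i j : Fin n) → i Fin.< j → σ ⟨$⟩ʳ j Fin.< σ ⟨$⟩ʳ i →
           π ≤ᴮ interchange i j σ → π ≤ᴮ σ

-- A reduction makes the one-line notation lexicographically smaller, so
-- the search for a sequence of reductions terminates.
private
  infix 4 _≺_

  _≺_ : ∀ {n} → 𝔖 n → 𝔖 n → Set
  π ≺ σ = Lex-< _≡_ Fin._<_ (tabulate (π ⟨$⟩ʳ_)) (tabulate (σ ⟨$⟩ʳ_))

  acc-≺ : ∀ {n} (σ : 𝔖 n) → Acc (Lex-< _≡_ Fin._<_) (tabulate (σ ⟨$⟩ʳ_)) → Acc _≺_ σ
  acc-≺ σ (acc rs) = acc λ {π} π≺σ → acc-≺ π (rs π≺σ)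

  ≺-wellFounded : ∀ {n} → WellFounded (_≺_ {n})
  ≺-wellFounded σ =
    acc-≺ σ (Lex.<-wellFounded trans (λ { refl p → p }) Finᵢ.<-wellFounded (tabulate (σ ⟨$⟩ʳ_)))

  tabulate-Lex : ∀ {m n} (f g : Fin m → Fin n) i →
                 (∀ k → k Fin.< i → f k ≡ g k) → f i Fin.< g i →
                 Lex-< _≡_ Fin._<_ (tabulate f) (tabulate g)
  tabulate-Lex f g zero    eq lt = this lt refl
  tabulate-Lex f g (suc i) eq lt =
    next (eq zero ℕ.z<s) (tabulate-Lex (f ∘ suc) (g ∘ suc) i (λ k k<i → eq (suc k) (ℕ.s<s k<i)) lt)

  interchange-first : ∀ {n} (σ : 𝔖 n) i j → interchange i j σ ⟨$⟩ʳ i ≡ σ ⟨$⟩ʳ j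
  interchange-first σ i j rewrite dec-true (i Finₚ.≟ i) refl = refl

  interchange-before : ∀ {n} (σ : 𝔖 n) {i j} k → i Fin.< j → k Fin.< i →
                       interchange i j σ ⟨$⟩ʳ k ≡ σ ⟨$⟩ʳ k
  interchange-before σ {i} {j} k i<j k<i
    rewrite dec-false (k Finₚ.≟ i) (Finₚ.<⇒≢ k<i)
          | dec-false (k Finₚ.≟ j) (Finₚ.<⇒≢ (ℕₚ.<-trans k<i i<j)) = refl

  interchange-≺ : ∀ {n} (σ : 𝔖 n) {i j} → i Fin.< j → σ ⟨$⟩ʳ j Fin.< σ ⟨$⟩ʳ i →
                  interchange i j σ ≺ σ
  interchange-≺ σ {i} {j} i<j inv = tabulate-Lex _ _ i
    (λ k → interchange-before σ k i<j)
    (subst (Fin._< σ ⟨$⟩ʳ i) (sym (interchange-first σ i j)) inv)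

  bruhat? : ∀ {n} (π σ : 𝔖 n) → Acc _≺_ σ → Dec (π ≤ᴮ σ)
  bruhat? {n} π σ (acc rs) with π ≈? σ
  ... | yes π≈σ = yes (done π≈σ)
  ... | no  π≉σ = map′
      (λ { (i , j , i<j , inv , p) → reduce i j i<j inv p })
      (λ { (done π≈σ) → contradiction π≈σ π≉σ ; (reduce i j i<j inv p) → i , j , i<j , inv , p })
      (Finₚ.any? λ i → Finₚ.any? λ j → below? i j)
    where
    below? : ∀ i j → Dec (i Fin.< j × σ ⟨$⟩ʳ j Fin.< σ ⟨$⟩ʳ i × π ≤ᴮ interchange i j σ)
    below? i j with i Finₚ.<? j | (σ ⟨$⟩ʳ j) Finₚ.<? (σ ⟨$⟩ʳ i)
    ... | no i≮j  | _       = no (i≮j ∘ proj₁)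
    ... | yes _   | no ¬inv = no (¬inv ∘ proj₁ ∘ proj₂)
    ... | yes i<j | yes inv = map′ (λ p → i<j , inv , p) (proj₂ ∘ proj₂)
                                (bruhat? π (interchange i j σ) (rs (interchange-≺ σ i<j inv)))

_≤ᴮ?_ : ∀ {n} (π σ : 𝔖 n) → Dec (π ≤ᴮ σ)
π ≤ᴮ? σ = bruhat? π σ (≺-wellFounded σ)

------------------------------------------------------------------------
-- Bigrassmannian permutations

Descent : ∀ {n} → 𝔖 n → Fin n → Set
Descent ω i = ∃[ j ] (toℕ j ≡ suc (toℕ i) × ω ⟨$⟩ʳ j Fin.< ω ⟨$⟩ʳ i)

descent? : ∀ {n} (ω : 𝔖 n) → Decidable (Descent ω)
descent? ω i =
  Finₚ.any? λ j → (toℕ j ℕₚ.≟ suc (toℕ i)) ×-dec ((ω ⟨$⟩ʳ j) Finₚ.<? (ω ⟨$⟩ʳ i))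

#descents : ∀ {n} → 𝔖 n → ℕ
#descents {n} ω = length (filter (descent? ω) (allFin n))

Bigrassmannian : ∀ {n} → 𝔖 n → Set
Bigrassmannian ω = #descents ω ≡ 1 × #descents (flip ω) ≡ 1

bigrassmannian? : ∀ {n} → Decidable (Bigrassmannian {n})
bigrassmannian? ω = (#descents ω ℕₚ.≟ 1) ×-dec (#descents (flip ω) ℕₚ.≟ 1)

𝔅 : ∀ n → List (𝔖 n)
𝔅 n = filter bigrassmannian? (permutations n)

β : ∀ {n} → 𝔖 n → ℕ
β {n} ω = length (filter (_≤ᴮ? ω) (𝔅 n))

α : ∀ {n} → 𝔖 n → ℕ
α {n} ω = length (filter (ω ≤ᴮ?_) (𝔅 n))

------------------------------------------------------------------------
-- Real numbers: two-sided Dedekind cuts of ℚ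

fromℕ : ℕ → ℚ
fromℕ n = fromℤ (ℤ.+ n)

-- L q means q < x, and U q means x < q.
record ℝ : Set₁ where
  field
    L U     : Pred ℚ 0ℓ
    L-∃     : ∃ L
    U-∃     : ∃ U
    L-down  : ∀ {q r} → q < r → L r → L q
    U-up    : ∀ {q r} → q < r → U q → U r
    L-open  : ∀ {q} → L q → ∃[ r ] (q < r × L r)
    U-open  : ∀ {r} → U r → ∃[ q ] (q < r × U q)
    disjoint : ∀ {q} → L q → ¬ U q
    located : ∀ {q r} → q < r → L q ⊎ U r

open ℝ

infix 4 _≤ᴿ_

_≤ᴿ_ : ℝ → ℝ → Set
x ≤ᴿ y = ∀ {q} → L x q → L y q

IsPositive : ℝ → Set
IsPositive x = L x 0ℚ

private
  L<U : ∀ (x : ℝ) {q r} → L x q → U x r → q < r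
  L<U x {q} {r} Lq Ur with ℚₚ.<-cmp q r
  ... | tri< q<r _ _ = q<r
  ... | tri≈ _ refl _ = contradiction Ur (disjoint x Lq)
  ... | tri> _ _ r<q = contradiction Ur (disjoint x (L-down x r<q Lq))

  q-1<q : ∀ q → q ℚ.- 1ℚ < q
  q-1<q q = subst (q ℚ.- 1ℚ <_) (ℚₚ.+-identityʳ q) (ℚₚ.+-monoʳ-< q (ℚₚ.negative⁻¹ (ℚ.- 1ℚ)))

  q<q+1 : ∀ q → q < q ℚ.+ 1ℚ
  q<q+1 q = subst (_< q ℚ.+ 1ℚ) (ℚₚ.+-identityʳ q) (ℚₚ.+-monoʳ-< q (ℚₚ.positive⁻¹ 1ℚ))

  <*-cancel : ∀ {q r t} → 0ℚ < t → q * t < r * t → q < r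
  <*-cancel {t = t} 0<t = ℚₚ.*-cancelʳ-<-nonNeg t {{ℚ.nonNegative (ℚₚ.<⇒≤ 0<t)}}

  <*-mono : ∀ {q r t} → 0ℚ < t → q < r → q * t < r * t
  <*-mono {t = t} 0<t = ℚₚ.*-monoˡ-<-pos t {{ℚ.positive 0<t}}

  ≤*-mono : ∀ {q r t} → 0ℚ ≤ t → q ≤ r → q * t ≤ r * t
  ≤*-mono {t = t} 0≤t = ℚₚ.*-monoʳ-≤-nonNeg t {{ℚ.nonNegative 0≤t}}

  quotient : ∀ q {t} → 0ℚ < t → ∃[ r ] r * t ≡ q
  quotient q {t} 0<t = q * ℚ.1/ t , (begin
      q * ℚ.1/ t * t     ≡⟨ ℚₚ.*-assoc q (ℚ.1/ t) t ⟩
      q * (ℚ.1/ t * t)   ≡⟨ cong (q *_) (ℚₚ.*-inverseˡ t) ⟩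
      q * 1ℚ             ≡⟨ ℚₚ.*-identityʳ q ⟩
      q                  ∎)
    where
    open ≡-Reasoning
    instance _ = ℚ.>-nonZero 0<t

  0≤fromℕ : ∀ n → 0ℚ ≤ fromℕ n
  0≤fromℕ n = ℚₚ.nonNegative⁻¹ (fromℕ n)

  0<fromℕ : ∀ n → 0ℚ < fromℕ (suc n)
  0<fromℕ n = ℚₚ.positive⁻¹ (fromℕ (suc n))

ℚ→ℝ : ℚ → ℝ
ℚ→ℝ c = record
  { L = _< c
  ; U = c <_
  ; L-∃ = c ℚ.- 1ℚ , q-1<q c
  ; U-∃ = c ℚ.+ 1ℚ , q<q+1 c
  ; L-down = ℚₚ.<-trans
  ; U-up = λ q<r c<q → ℚₚ.<-trans c<q q<r
  ; L-open = ℚₚ.<-dense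
  ; U-open = λ c<r → let m , c<m , m<r = ℚₚ.<-dense c<r in m , m<r , c<m
  ; disjoint = λ q<c → ℚₚ.<-asym q<c
  ; located = loc
  }
  where
  loc : ∀ {q r} → q < r → q < c ⊎ c < r
  loc {q} q<r with q ℚₚ.<? c
  ... | yes q<c = inj₁ q<c
  ... | no  q≮c = inj₂ (ℚₚ.≤-<-trans (ℚₚ.≮⇒≥ q≮c) q<r)

ℕ→ℝ : ℕ → ℝ
ℕ→ℝ n = ℚ→ℝ (fromℕ n)

infixl 7 _·_

_·_ : ℝ → ℕ → ℝ
x · c = record
  { L = λ q → ∃[ r ] (L x r × q < r * fromℕ c)
  ; U = λ q → ∃[ r ] (U x r × r * fromℕ c < q)
  ; L-∃ = let r , Lr = L-∃ x in (r * fromℕ c) ℚ.- 1ℚ , r , Lr , q-1<q _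
  ; U-∃ = let r , Ur = U-∃ x in (r * fromℕ c) ℚ.+ 1ℚ , r , Ur , q<q+1 _
  ; L-down = λ { p<q (r , Lr , q<rc) → r , Lr , ℚₚ.<-trans p<q q<rc }
  ; U-up = λ { q<p (r , Ur , rc<q) → r , Ur , ℚₚ.<-trans rc<q q<p }
  ; L-open = λ { (r , Lr , q<rc) →
      let m , q<m , m<rc = ℚₚ.<-dense q<rc in m , q<m , r , Lr , m<rc }
  ; U-open = λ { (r , Ur , rc<q) →
      let m , rc<m , m<q = ℚₚ.<-dense rc<q in m , m<q , r , Ur , rc<m }
  ; disjoint = λ { (r , Lr , q<rc) (s , Us , sc<q) →
      ℚₚ.<-irrefl refl (ℚₚ.<-≤-trans (ℚₚ.<-trans sc<q q<rc)
        (≤*-mono (0≤fromℕ c) (ℚₚ.<⇒≤ (L<U x Lr Us)))) }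
  ; located = loc c
  }
  where
  loc-pos : ∀ {t q q′} → 0ℚ < t → q < q′ →
            (∃[ r ] (L x r × q < r * t)) ⊎ (∃[ r ] (U x r × r * t < q′))
  loc-pos {t} {q} {q′} 0<t q<q′ with quotient q 0<t | quotient q′ 0<t
  ... | r , rt≡q | r′ , r′t≡q′
    with located x (<*-cancel {r} {r′} 0<t (subst₂ _<_ (sym rt≡q) (sym r′t≡q′) q<q′))
  ... | inj₁ Lr  = let s , r<s , Ls = L-open x Lr in
      inj₁ (s , Ls , subst (_< s * t) rt≡q (<*-mono 0<t r<s))
  ... | inj₂ Ur′ = let s , s<r′ , Us = U-open x Ur′ in
      inj₂ (s , Us , subst (s * t <_) r′t≡q′ (<*-mono 0<t s<r′))

  loc : ∀ c {q q′} → q < q′ →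
        (∃[ r ] (L x r × q < r * fromℕ c)) ⊎ (∃[ r ] (U x r × r * fromℕ c < q′))
  loc zero {q} q<q′ with q ℚₚ.<? 0ℚ
  ... | yes q<0 = let r , Lr = L-∃ x in inj₁ (r , Lr , subst (q <_) (sym (ℚₚ.*-zeroʳ r)) q<0)
  ... | no  q≮0 = let r , Ur = U-∃ x in
      inj₂ (r , Ur , subst (_< _) (sym (ℚₚ.*-zeroʳ r)) (ℚₚ.≤-<-trans (ℚₚ.≮⇒≥ q≮0) q<q′))
  loc (suc c) q<q′ = loc-pos (0<fromℕ c) q<q′

recip : (x : ℝ) → IsPositive x → ℝ
recip x 0<x = record
  { L = λ q → ∃[ r ] (U x r × q * r < 1ℚ)
  ; U = λ q → ∃[ r ] (0ℚ < r × L x r × 1ℚ < q * r)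
  ; L-∃ = let r , Ur = U-∃ x in
      0ℚ , r , Ur , subst (_< 1ℚ) (sym (ℚₚ.*-zeroˡ r)) (ℚₚ.positive⁻¹ 1ℚ)
  ; U-∃ = let r , 0<r , Lr = L-open x 0<x
              q , qr≡2 = quotient (1ℚ ℚ.+ 1ℚ) 0<r
          in q , r , 0<r , Lr , subst (1ℚ <_) (sym qr≡2) (q<q+1 1ℚ)
  ; L-down = λ { p<q (r , Ur , qr<1) → r , Ur , ℚₚ.<-trans (<*-mono (U⇒pos Ur) p<q) qr<1 }
  ; U-up = λ { q<p (r , 0<r , Lr , 1<qr) → r , 0<r , Lr , ℚₚ.<-trans 1<qr (<*-mono 0<r q<p) }
  ; L-open = λ { {q} (r , Ur , qr<1) →
      let m , qr<m , m<1 = ℚₚ.<-dense qr<1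
          p , pr≡m = quotient m (U⇒pos Ur)
      in p , <*-cancel (U⇒pos Ur) (subst (q * r <_) (sym pr≡m) qr<m)
           , r , Ur , subst (_< 1ℚ) (sym pr≡m) m<1 }
  ; U-open = λ { {q} (r , 0<r , Lr , 1<qr) →
      let m , 1<m , m<qr = ℚₚ.<-dense 1<qr
          p , pr≡m = quotient m 0<r
      in p , <*-cancel 0<r (subst (_< q * r) (sym pr≡m) m<qr)
           , r , 0<r , Lr , subst (1ℚ <_) (sym pr≡m) 1<m }
  ; disjoint = λ { {q} (r , Ur , qr<1) (s , 0<s , Ls , 1<qs) →
      let 0<q = <*-cancel 0<s (subst (_< q * s) (sym (ℚₚ.*-zeroˡ s))
                                 (ℚₚ.<-trans (ℚₚ.positive⁻¹ 1ℚ) 1<qs))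
          qs<qr = subst₂ _<_ (ℚₚ.*-comm s q) (ℚₚ.*-comm r q) (<*-mono 0<q (L<U x Ls Ur))
      in ℚₚ.<-asym 1<qs (ℚₚ.<-trans qs<qr qr<1) }
  ; located = loc
  }
  where
  U⇒pos : ∀ {r} → U x r → 0ℚ < r
  U⇒pos = L<U x 0<x

  pos-factor : ∀ {q r} → 0ℚ < q → r * q ≡ 1ℚ → 0ℚ < r
  pos-factor {q} 0<q rq≡1 =
    <*-cancel 0<q (subst₂ _<_ (sym (ℚₚ.*-zeroˡ q)) (sym rq≡1) (ℚₚ.positive⁻¹ 1ℚ))

  loc : ∀ {q q′} → q < q′ →
        (∃[ r ] (U x r × q * r < 1ℚ)) ⊎ (∃[ r ] (0ℚ < r × L x r × 1ℚ < q′ * r))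
  loc {q} {q′} q<q′ with 0ℚ ℚₚ.<? q
  ... | no 0≮q = let r , Ur = U-∃ x in
      inj₁ (r , Ur , ℚₚ.≤-<-trans (subst (q * r ≤_) (ℚₚ.*-zeroˡ r)
                                     (≤*-mono (ℚₚ.<⇒≤ (U⇒pos Ur)) (ℚₚ.≮⇒≥ 0≮q)))
                                  (ℚₚ.positive⁻¹ 1ℚ))
  ... | yes 0<q with quotient 1ℚ 0<q | quotient 1ℚ (ℚₚ.<-trans 0<q q<q′)
  ... | r , rq≡1 | r′ , r′q′≡1 with located x r′<r
    where
    0<q′ = ℚₚ.<-trans 0<q q<q′
    0<r′ = pos-factor 0<q′ r′q′≡1
    r′<r : r′ < r
    r′<r = <*-cancel 0<q (subst (r′ * q <_) (trans r′q′≡1 (sym rq≡1))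
             (subst₂ _<_ (ℚₚ.*-comm q r′) (ℚₚ.*-comm q′ r′) (<*-mono 0<r′ q<q′)))
  ... | inj₁ Lr′ = let s , r′<s , Ls = L-open x Lr′ in
      inj₂ (s , ℚₚ.<-trans (pos-factor (ℚₚ.<-trans 0<q q<q′) r′q′≡1) r′<s , Ls ,
            subst₂ _<_ r′q′≡1 (ℚₚ.*-comm s q′) (<*-mono (ℚₚ.<-trans 0<q q<q′) r′<s))
  ... | inj₂ Ur  = let s , s<r , Us = U-open x Ur in
      inj₁ (s , Us , subst₂ _<_ (ℚₚ.*-comm s q) rq≡1 (<*-mono 0<q s<r))

infixl 7 _/[_,_]

_/[_,_] : ℕ → (x : ℝ) → IsPositive x → ℝ
c /[ x , 0<x ] = recip x 0<x · c

Tends-to-∞ : (ℕ → ℝ) → Set₁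
Tends-to-∞ h = ∀ (M : ℝ) → ∃[ N ] (∀ n → N ℕ.≤ n → M ≤ᴿ h n)

------------------------------------------------------------------------
-- Uniform probability on 𝔅 n

-- q ≤ℙ E says q ≤ ℙ(E), for ω uniform in 𝔅 n.  Events comparing real
-- numbers are not decidable, so the favourable outcomes cannot simply be
-- filtered out and counted; ℙ(E) ≥ q is instead witnessed by a list of
-- distinct favourable outcomes making up at least a proportion q of 𝔅 n.
infix 4 _≤ℙ_

_≤ℙ_ : ∀ {n} → ℚ → Pred (𝔖 n) 0ℓ → Set
_≤ℙ_ {n} q E =
  ∃[ ωs ] (ωs ⊆ 𝔅 n × All E ωs × q * fromℕ (length (𝔅 n)) ≤ fromℕ (length ωs))

-- ℙ(Eₙ) → 1; the upper bound ℙ(Eₙ) ≤ 1 is automatic.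
With-high-probability : (∀ n → Pred (𝔖 n) 0ℓ) → Set
With-high-probability E =
  ∀ ε → 0ℚ < ε → ∃[ N ] (∀ n → N ℕ.≤ n → (1ℚ ℚ.- ε) ≤ℙ E n)

{-# OPTIONS --safe #-}

-- A bigrassmannian permutation exchanges two adjacent blocks of consecutive entries, so it is described by
-- the number a of entries before the blocks and by the lengths r and s of the two blocks; inversion exchanges
-- r and s.  Hence 𝔅 n has between c n³ and n³ elements, which already gives the upper bounds for α and β.
-- Shortening a block by one, with or without increasing a, goes down in Bruhat order, so (a + i , r , s) lies
-- below (a , i + j + r , k + s).  If a, r, s and the number of entries after the blocks are all at least 2e, varying
-- i, j, k < e gives e³ elements above and e³ elements below.  At most 8en² of the triples (a , r , s) violate
-- this condition, which is a proportion at most ε of 𝔅 n when e is a small multiple of n.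

module Submission where

open import Defs
open import Data.Bool.Base using (true; false)
open import Data.Empty using (⊥-elim)
open import Data.Fin.Base as Fin using (Fin; zero; suc; toℕ; fromℕ<)
open import Data.Fin.Patterns using (0F; 1F; 2F; 3F)
import Data.Fin.Permutation.Components as PC
open import Data.Fin.Permutation as Perm using (_⟨$⟩ʳ_; _⟨$⟩ˡ_; _≈_; flip)
import Data.Fin.Properties as Finₚ
open import Data.Integer.Base as ℤ using (-[1+_]; +[1+_])
import Data.Integer.Properties as ℤₚ
open import Data.List.Base using (List; []; _∷_; length; filter; allFin; lookup)
open import Data.List.Membership.Propositional using (_∈_; find)
open import Data.List.Membership.Propositional.Properties using (∈-allFin; ∈-filter⁺; ∈-filter⁻; ∈-lookup)
open import Data.List.Properties using (length-filter)
open import Data.List.Relation.Binary.Sublist.Propositional.Properties using (filter-⊆)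
open import Data.List.Relation.Unary.All as All using ([]; _∷_)
import Data.List.Relation.Unary.All.Properties as Allₚ
open import Data.List.Relation.Unary.AllPairs using ([]; _∷_)
open import Data.List.Relation.Unary.Any as Any using (here; there)
import Data.List.Relation.Unary.Any.Properties as Anyₚ
import Data.List.Relation.Unary.Unique.Propositional.Properties as Uniqueₚ
import Data.List.Relation.Unary.Unique.Setoid as Unique
import Data.List.Relation.Unary.Unique.Setoid.Properties as UniqueSetoidₚ
open import Data.Nat.Base
  using (ℕ; zero; suc; _+_; _*_; _∸_; _^_; _⊔_; _≤_; _<_; z≤n; s≤s; z<s; s<s; s≤s⁻¹; s<s⁻¹; NonZero)
open import Data.Nat.DivMod using (_/_; _%_; m≡m%n+[m/n]*n; m%n<n; m/n*n≤m; m≥n⇒m/n>0)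
open import Data.Nat.Properties
open import Data.Nat.Tactic.RingSolver using (solve-∀)
open import Data.Product.Base using (_×_; _,_; ∃-syntax; proj₁; proj₂)
open import Data.Product.Function.NonDependent.Propositional using (_×-↔_)
open import Data.Rational.Base as ℚ using (mkℚ; 0ℚ; 1ℚ; *≤*; *<*)
import Data.Rational.Properties as ℚₚ
import Data.Rational.Unnormalised.Base as ℚᵘ
import Data.Rational.Unnormalised.Properties as ℚᵘₚ
open import Data.Sum.Base using (_⊎_; inj₁; inj₂; [_,_]′; map₂)
open import Function.Base using (_∘_; id)
open import Function.Bundles using (_↔_; Inverse)
open import Function.Construct.Composition using (_↔-∘_)
open import Function.Construct.Identity using (↔-id)
open import Level using (0ℓ)
open import Relation.Binary.Definitions using (Tri; tri<; tri≈; tri>)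
open import Relation.Binary.PropositionalEquality
open import Relation.Nullary.Decidable using (Dec; yes; no; does; dec-true; dec-false; _×-dec_)
open import Relation.Nullary.Negation using (¬_; contradiction)
open import Relation.Unary using (Pred; Decidable)
open import Relation.Unary.Properties using (∁?)
open ℝ

-- Block interchanges on ℕ

-- The event of the theorem compares Dedekind cuts and cannot be tested, so it is replaced by the
-- testable inequalities n³ ≤ K α and n³ ≤ K β for an integer K that depends on ε alone; divergence
-- of h serves only to bring h n up to K. Since `𝔅 n` is defined by counting descents, its
-- parametrization is needed in both directions: triples yield members for the lower bounds, members
-- yield triples for the upper bounds. The lower bounds for α and β only ask that certain pairs be
-- comparable, so explicit chains of reductions suffice and no criterion for the Bruhat order
-- enters. The width 2e, rather than e, comes from two sums of offsets: going down, a shift by i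
-- must still leave j + 1 entries in the first block; going up, the right end of the blocks moves by
-- j + k.

+-swap : ∀ a r s → a + r + s ≡ a + s + r
+-swap = solve-∀

rotation : ℕ → ℕ → ℕ → ℕ
rotation r s i with i <? r
... | yes _ = s + i
... | no  _ with i <? r + s
...   | yes _ = i ∸ r
...   | no  _ = i

-- Recursion on a strips the leading fixed entries, so statements about `block` reduce to a = 0.
-- Being total on ℕ, it leaves the bound by n to `block-<`.
block : ℕ → ℕ → ℕ → ℕ → ℕ
block zero    r s i       = rotation r s i
block (suc a) r s zero    = zero
block (suc a) r s (suc i) = suc (block a r s i)

block-below : ∀ {a r s i} → i < a → block a r s i ≡ i
block-below {suc a} {i = zero}  _   = refl
block-below {suc a} {i = suc i} i<a = cong suc (block-below (s<s⁻¹ i<a))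

block-left : ∀ a {r s j} → j < r → block a r s (a + j) ≡ a + s + j
block-left (suc a) j<r = cong suc (block-left a j<r)
block-left zero {r} {j = j} j<r with j <? r
... | yes _   = refl
... | no  j≮r = contradiction j<r j≮r

block-right : ∀ a {r s j} → j < s → block a r s (a + r + j) ≡ a + j
block-right (suc a) j<s = cong suc (block-right a j<s)
block-right zero {r} {s} {j} j<s with r + j <? r
... | yes r+j<r = contradiction r+j<r (m+n≮m r j)
... | no  _ with r + j <? r + s
...   | yes _     = m+n∸m≡n r j
...   | no  r+j≮r+s = contradiction (+-monoʳ-< r j<s) r+j≮r+s

block-above : ∀ a {r s i} → a + r + s ≤ i → block a r s i ≡ i
block-above (suc a) {i = suc i} (s≤s le) = cong suc (block-above a le)
block-above zero {r} {s} {i} le with i <? r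
... | yes i<r = contradiction i<r (≤⇒≯ (m+n≤o⇒m≤o r le))
... | no  _ with i <? r + s
...   | yes i<r+s = contradiction i<r+s (≤⇒≯ le)
...   | no  _     = refl

-- A view of positions: matching on it replaces a position inside a block by its offset j, the form
-- in which the evaluation lemmas apply.
data Region (a r s : ℕ) : ℕ → Set where
  below : ∀ {i} → i < a → Region a r s i
  left  : ∀ {j} → j < r → Region a r s (a + j)
  right : ∀ {j} → j < s → Region a r s (a + r + j)
  above : ∀ {i} → a + r + s ≤ i → Region a r s i

region : ∀ a r s i → Region a r s i
region (suc a) r s zero    = below z<s
region (suc a) r s (suc i) with region a r s i
... | below i<a = below (s<s i<a)
... | left j<r  = left j<r
... | right j<s = right j<s
... | above le  = above (s≤s le)
region zero r s i with i <? r
... | yes i<r = left i<r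
... | no  i≮r with i <? r + s
...   | no  i≮r+s = above (≮⇒≥ i≮r+s)
...   | yes i<r+s with m≤n⇒∃[o]m+o≡n (≮⇒≥ i≮r)
...     | j , refl = right (+-cancelˡ-< r j s i<r+s)

block-inverse : ∀ a r s i → block a s r (block a r s i) ≡ i
block-inverse a r s i with region a r s i
... | below i<a = trans (cong (block a s r) (block-below i<a)) (block-below i<a)
... | left j<r  = trans (cong (block a s r) (block-left a j<r)) (block-right a j<r)
... | right j<s = trans (cong (block a s r) (block-right a j<s)) (block-left a j<s)
... | above le  = trans (cong (block a s r) (block-above a le)) (block-above a (subst (_≤ i) (+-swap a r s) le))

block-< : ∀ a r s {n i} → a + r + s ≤ n → i < n → block a r s i < n
block-< a r s {n} {i} le i<n with region a r s i
... | below i<a     = subst (_< n) (sym (block-below i<a)) i<n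
... | above le′     = subst (_< n) (sym (block-above a le′)) i<n
... | left {j} j<r  = subst (_< n) (sym (block-left a j<r)) (begin-strict
    a + s + j   <⟨ +-monoʳ-< (a + s) j<r ⟩
    a + s + r   ≡⟨ +-swap a s r ⟩
    a + r + s   ≤⟨ le ⟩
    n           ∎)
  where open ≤-Reasoning
... | right {j} j<s = subst (_< n) (sym (block-right a j<s)) (begin-strict
    a + j       ≤⟨ +-monoˡ-≤ j (m≤m+n a r) ⟩
    a + r + j   <⟨ +-monoʳ-< (a + r) j<s ⟩
    a + r + s   ≤⟨ le ⟩
    n           ∎)
  where open ≤-Reasoning

block-drop : ∀ a r s → block a (suc r) (suc s) (suc (a + r)) < block a (suc r) (suc s) (a + r)
block-drop a r s = subst₂ _<_ (sym right-0) (sym (block-left a (n<1+n r)))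
    (≤-trans (m<m+n a z<s) (m≤m+n (a + suc s) r))
  where
  position : ∀ a r → suc (a + r) ≡ a + suc r + 0
  position = solve-∀
  right-0 : block a (suc r) (suc s) (suc (a + r)) ≡ a
  right-0 = trans (cong (block a _ _) (position a r)) (trans (block-right a z<s) (+-identityʳ a))

-- Inside a region consecutive values differ by one, and at the two borders other than the one
-- between the blocks the value rises. With `block-drop` this leaves exactly one descent.
block-step : ∀ a r s i → i ≢ a + r → block a (suc r) s i < block a (suc r) s (suc i)
block-step a r s i i≢ with region a (suc r) s i
... | below i<a with suc i <? a
...   | yes 1+i<a = subst₂ _<_ (sym (block-below i<a)) (sym (block-below 1+i<a)) (n<1+n i)
...   | no  1+i≮a with ≤-antisym (≮⇒≥ 1+i≮a) i<a
...     | refl = subst₂ _<_ (sym (block-below i<a))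
    (trans (sym (block-left (suc i) z<s)) (cong (block (suc i) _ _) (+-identityʳ (suc i))))
    (≤-trans (m≤m+n (suc i) s) (m≤m+n _ 0))
block-step a r s .(a + j) i≢ | left {j} j≤r =
  subst₂ _<_ (sym (block-left a j≤r))
    (trans (sym (block-left a (s<s j<r))) (cong (block a _ _) (+-suc a j)))
    (+-monoʳ-< (a + s) (n<1+n j))
  where
  j<r : j < r
  j<r = ≤∧≢⇒< (s≤s⁻¹ j≤r) (i≢ ∘ cong (a +_))
block-step a r s .(a + suc r + j) i≢ | right {j} j<s with suc j <? s
... | yes 1+j<s = subst₂ _<_ (sym (block-right a j<s))
    (trans (sym (block-right a 1+j<s)) (cong (block a _ _) (+-suc (a + suc r) j)))
    (+-monoʳ-< a (n<1+n j))
... | no  1+j≮s = subst₂ _<_ (sym (block-right a j<s))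
    (sym (block-above a (≤-trans (+-monoʳ-≤ (a + suc r) (≮⇒≥ 1+j≮s)) (≤-reflexive (+-suc _ j)))))
    (s≤s (+-monoˡ-≤ j (m≤m+n a (suc r))))
block-step a r s i i≢ | above le =
  subst₂ _<_ (sym (block-above a le)) (sym (block-above a (m≤n⇒m≤1+n le))) (n<1+n i)

-- Permutations interchanging two adjacent blocks

-- Shape a r s ω says that ω is the paper's permutation with parameters (a, b, c) = (a, a + s, a + r + s).
record Shape {n} (a r s : ℕ) (ω : 𝔖 n) : Set where
  constructor shape
  field value : ∀ i → toℕ (ω ⟨$⟩ʳ i) ≡ block a r s (toℕ i)

open Shape

shape-≈ : ∀ {n a r s} {π σ : 𝔖 n} → Shape a r s π → Shape a r s σ → π ≈ σ
shape-≈ π-shape σ-shape i = Finₚ.toℕ-injective (trans (value π-shape i) (sym (value σ-shape i)))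

shape-respˡ : ∀ {n a r s} {π σ : 𝔖 n} → π ≈ σ → Shape a r s π → Shape a r s σ
shape-respˡ π≈σ π-shape = shape λ i → trans (cong toℕ (sym (π≈σ i))) (value π-shape i)

shape-flip : ∀ {n a r s} (ω : 𝔖 n) → Shape a r s ω → Shape a s r (flip ω)
shape-flip {a = a} {r} {s} ω ω-shape = shape λ v → begin
    toℕ (ω ⟨$⟩ˡ v)                                  ≡⟨ block-inverse a r s _ ⟨
    block a s r (block a r s (toℕ (ω ⟨$⟩ˡ v)))      ≡⟨ cong (block a s r) (value ω-shape (ω ⟨$⟩ˡ v)) ⟨
    block a s r (toℕ (ω ⟨$⟩ʳ (ω ⟨$⟩ˡ v)))           ≡⟨ cong (block a s r ∘ toℕ) (Perm.inverseʳ ω) ⟩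
    block a s r (toℕ v)                             ∎
  where open ≡-Reasoning

block-fin : ∀ {n} a r s → a + r + s ≤ n → Fin n → Fin n
block-fin a r s le i = fromℕ< (block-< a r s le (Finₚ.toℕ<n i))

block-perm : ∀ {n} a r s → a + r + s ≤ n → 𝔖 n
block-perm {n} a r s le =
    Perm.permutation (block-fin a r s le) (block-fin a s r le′) (inverse a s r le′ le) (inverse a r s le le′)
  where
  le′ : a + s + r ≤ n
  le′ = subst (_≤ n) (+-swap a r s) le
  inverse : ∀ a r s (le : a + r + s ≤ n) (le′ : a + s + r ≤ n) i →
            block-fin a s r le′ (block-fin a r s le i) ≡ i
  inverse a r s le le′ i = Finₚ.toℕ-injective (begin
      toℕ (block-fin a s r le′ (block-fin a r s le i))   ≡⟨ Finₚ.toℕ-fromℕ< _ ⟩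
      block a s r (toℕ (block-fin a r s le i))           ≡⟨ cong (block a s r) (Finₚ.toℕ-fromℕ< _) ⟩
      block a s r (block a r s (toℕ i))                  ≡⟨ block-inverse a r s (toℕ i) ⟩
      toℕ i                                              ∎)
    where open ≡-Reasoning

block-perm-shape : ∀ {n} a r s (le : a + r + s ≤ n) → Shape a r s (block-perm a r s le)
block-perm-shape a r s le = shape λ _ → Finₚ.toℕ-fromℕ< _

-- Blocks starting at a move position a to a + suc s, whereas blocks starting later fix it.
block-≢ : ∀ {a a′ r r′ s s′} → a < a′ → block a (suc r) (suc s) a ≢ block a′ r′ s′ a
block-≢ {a} {a′} {r} {s = s} a<a′ eq = <⇒≢ (≤-trans (m<m+n a z<s) (m≤m+n (a + suc s) 0)) (begin
    a                                    ≡⟨ block-below a<a′ ⟨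
    block a′ _ _ a                       ≡⟨ eq ⟨
    block a (suc r) (suc s) a            ≡⟨ cong (block a _ _) (+-identityʳ a) ⟨
    block a (suc r) (suc s) (a + 0)      ≡⟨ block-left a z<s ⟩
    a + suc s + 0                        ∎)
  where open ≡-Reasoning

-- For nonempty blocks a is the first moved position, and the value there gives s; the inverse gives
-- r in the same way.
shape-injective : ∀ {n a r s a′ r′ s′} (ω : 𝔖 n) →
                  a + suc r + suc s ≤ n → a′ + suc r′ + suc s′ ≤ n →
                  Shape a (suc r) (suc s) ω → Shape a′ (suc r′) (suc s′) ω →
                  a ≡ a′ × r ≡ r′ × s ≡ s′
shape-injective {n} {a} {r} {s} {a′} {r′} {s′} ω le le′ ω-shape ω-shape′ =
    a≡a′ , first-block s s′ (flip ω) a≡a′ (shape-flip ω ω-shape) (shape-flip ω ω-shape′)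
         , first-block r r′ ω a≡a′ ω-shape ω-shape′
  where
  a<n : ∀ {a r s} → a + suc r + suc s ≤ n → a < n
  a<n {a} {r} {s} le = ≤-trans (m<m+n a z<s) (m+n≤o⇒m≤o (a + suc r) le)

  block-≡ : ∀ {a r s a′ r′ s′ i} (ω : 𝔖 n) → Shape a r s ω → Shape a′ r′ s′ ω → i < n →
            block a r s i ≡ block a′ r′ s′ i
  block-≡ {a} {r} {s} {a′} {r′} {s′} ω ω-shape ω-shape′ i<n =
    subst (λ i → block a r s i ≡ block a′ r′ s′ i) (Finₚ.toℕ-fromℕ< i<n)
      (trans (sym (value ω-shape _)) (value ω-shape′ _))

  a≡a′ : a ≡ a′
  a≡a′ with <-cmp a a′
  ... | tri≈ _ eq _ = eq
  ... | tri< a<a′ _ _ =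
    contradiction (block-≡ ω ω-shape ω-shape′ (a<n {a} le)) (block-≢ a<a′)
  ... | tri> _ _ a′<a =
    contradiction (block-≡ ω ω-shape′ ω-shape (a<n {a′} le′)) (block-≢ a′<a)

  first-block : ∀ {s s′} r r′ (ω : 𝔖 n) → a ≡ a′ →
                Shape a (suc r) (suc s) ω → Shape a′ (suc r′) (suc s′) ω → s ≡ s′
  first-block {s} {s′} r r′ ω refl ω-shape ω-shape′ =
      suc-injective (+-cancelˡ-≡ a _ _ (+-cancelʳ-≡ 0 _ _ (begin
      a + suc s + 0                      ≡⟨ block-left a z<s ⟨
      block a (suc r) (suc s) (a + 0)    ≡⟨ block-≡ ω ω-shape ω-shape′ (subst (_< n) (sym (+-identityʳ a)) (a<n {a} le)) ⟩
      block a (suc r′) (suc s′) (a + 0)  ≡⟨ block-left a z<s ⟩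
      a + suc s′ + 0                     ∎)))
    where open ≡-Reasoning

-- Bruhat order

transpose-first : ∀ {n} (i j : Fin n) → PC.transpose i j i ≡ j
transpose-first i j rewrite dec-true (i Finₚ.≟ i) refl = refl

transpose-second : ∀ {n} (i j : Fin n) → PC.transpose i j j ≡ i
transpose-second i j with j Finₚ.≟ i
... | yes j≡i = j≡i
... | no  _ rewrite dec-true (j Finₚ.≟ j) refl = refl

transpose-other : ∀ {n} {i j k : Fin n} → k ≢ i → k ≢ j → PC.transpose i j k ≡ k
transpose-other {i = i} {j} {k} k≢i k≢j
  rewrite dec-false (k Finₚ.≟ i) k≢i | dec-false (k Finₚ.≟ j) k≢j = refl

≈⇒flip-≈ : ∀ {n} {π σ : 𝔖 n} → π ≈ σ → flip π ≈ flip σ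
≈⇒flip-≈ {π = π} {σ} π≈σ v = begin
    π ⟨$⟩ˡ v                        ≡⟨ Perm.inverseˡ σ ⟨
    σ ⟨$⟩ˡ (σ ⟨$⟩ʳ (π ⟨$⟩ˡ v))      ≡⟨ cong (σ ⟨$⟩ˡ_) (π≈σ _) ⟨
    σ ⟨$⟩ˡ (π ⟨$⟩ʳ (π ⟨$⟩ˡ v))      ≡⟨ cong (σ ⟨$⟩ˡ_) (Perm.inverseʳ π) ⟩
    σ ⟨$⟩ˡ v                        ∎
  where open ≡-Reasoning

≤ᴮ-respʳ-≈ : ∀ {n} {π σ τ : 𝔖 n} → σ ≈ τ → π ≤ᴮ σ → π ≤ᴮ τ
≤ᴮ-respʳ-≈ σ≈τ (done π≈σ) = done λ i → trans (π≈σ i) (σ≈τ i)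
≤ᴮ-respʳ-≈ σ≈τ (reduce i j i<j inv π≤) =
  reduce i j i<j (subst₂ Fin._<_ (σ≈τ j) (σ≈τ i) inv) (≤ᴮ-respʳ-≈ (σ≈τ ∘ PC.transpose i j) π≤)

≤ᴮ-trans : ∀ {n} {π σ τ : 𝔖 n} → π ≤ᴮ σ → σ ≤ᴮ τ → π ≤ᴮ τ
≤ᴮ-trans π≤σ (done σ≈τ)               = ≤ᴮ-respʳ-≈ σ≈τ π≤σ
≤ᴮ-trans π≤σ (reduce i j i<j inv σ≤)  = reduce i j i<j inv (≤ᴮ-trans π≤σ σ≤)

-- Conjugation by σ turns a transposition of positions into one of values. The value at j comes
-- first because it is the smaller one in a reduction.
interchange-flip : ∀ {n} (σ : 𝔖 n) i j →
                   flip (interchange i j σ) ≈ interchange (σ ⟨$⟩ʳ j) (σ ⟨$⟩ʳ i) (flip σ)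
interchange-flip σ i j v = trans (conjugate (σ ⟨$⟩ˡ v))
    (cong (λ v → σ ⟨$⟩ˡ PC.transpose (σ ⟨$⟩ʳ j) (σ ⟨$⟩ʳ i) v) (Perm.inverseʳ σ))
  where
  σ-injective : ∀ {k l} → σ ⟨$⟩ʳ k ≡ σ ⟨$⟩ʳ l → k ≡ l
  σ-injective {k} {l} eq = trans (sym (Perm.inverseˡ σ)) (trans (cong (σ ⟨$⟩ˡ_) eq) (Perm.inverseˡ σ))

  conjugate : ∀ k → PC.transpose j i k ≡ σ ⟨$⟩ˡ PC.transpose (σ ⟨$⟩ʳ j) (σ ⟨$⟩ʳ i) (σ ⟨$⟩ʳ k)
  conjugate k with k Finₚ.≟ j
  ... | yes refl = sym (trans (cong (σ ⟨$⟩ˡ_) (transpose-first (σ ⟨$⟩ʳ k) (σ ⟨$⟩ʳ i))) (Perm.inverseˡ σ))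
  ... | no k≢j with k Finₚ.≟ i
  ...   | yes refl = sym (trans (cong (σ ⟨$⟩ˡ_) (transpose-second (σ ⟨$⟩ʳ j) (σ ⟨$⟩ʳ k))) (Perm.inverseˡ σ))
  ...   | no k≢i   = sym (trans
      (cong (σ ⟨$⟩ˡ_) (transpose-other (k≢j ∘ σ-injective) (k≢i ∘ σ-injective))) (Perm.inverseˡ σ))

-- An inversion of σ at i < j is an inversion of the inverse at σ(j) < σ(i): the two inequalities
-- demanded by `reduce` exchange roles.
≤ᴮ-flip : ∀ {n} {π σ : 𝔖 n} → π ≤ᴮ σ → flip π ≤ᴮ flip σ
≤ᴮ-flip {π = π} {σ} (done π≈σ) = done (≈⇒flip-≈ {π = π} {σ} π≈σ)
≤ᴮ-flip {σ = σ} (reduce i j i<j inv π≤) =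
  reduce (σ ⟨$⟩ʳ j) (σ ⟨$⟩ʳ i) inv
    (subst₂ Fin._<_ (sym (Perm.inverseˡ σ)) (sym (Perm.inverseˡ σ)) i<j)
    (≤ᴮ-respʳ-≈ (interchange-flip σ i j) (≤ᴮ-flip π≤))

-- The reductions interchange position x with z, z − 1, …, y in this order.
cycle-≤ᴮ : ∀ {n} m (π σ : 𝔖 n) (x y z : Fin n) → toℕ z ≡ toℕ y + m → x Fin.< y →
           (∀ k → k ≢ x → k Fin.< y ⊎ z Fin.< k → π ⟨$⟩ʳ k ≡ σ ⟨$⟩ʳ k) →
           π ⟨$⟩ʳ x ≡ σ ⟨$⟩ʳ y →
           (∀ k l → toℕ l ≡ suc (toℕ k) → y Fin.≤ k → l Fin.≤ z →
              π ⟨$⟩ʳ k ≡ σ ⟨$⟩ʳ l × σ ⟨$⟩ʳ k Fin.< σ ⟨$⟩ʳ l) →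
           π ⟨$⟩ʳ z ≡ σ ⟨$⟩ʳ x → σ ⟨$⟩ʳ z Fin.< σ ⟨$⟩ʳ x → π ≤ᴮ σ
cycle-≤ᴮ zero π σ x y z z≡y+0 x<y outside at-x inside at-z inv
  with Finₚ.toℕ-injective (trans z≡y+0 (+-identityʳ _))
... | refl = reduce x y x<y inv (done agree)
  where
  agree : π ≈ interchange x y σ
  agree k = by-position k (k Finₚ.≟ x) (k Finₚ.≟ y) (<-cmp (toℕ k) (toℕ y))
    where
    by-position : ∀ k → Dec (k ≡ x) → Dec (k ≡ y) → Tri (k Fin.< y) (toℕ k ≡ toℕ y) (y Fin.< k) →
                  π ⟨$⟩ʳ k ≡ interchange x y σ ⟨$⟩ʳ k
    by-position _ (yes refl) _          _ = trans at-x (sym (cong (σ ⟨$⟩ʳ_) (transpose-first x y)))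
    by-position _ (no _)     (yes refl) _ = trans at-z (sym (cong (σ ⟨$⟩ʳ_) (transpose-second x y)))
    by-position k (no k≢x) (no k≢y) cmp =
        trans (outside k k≢x (apart cmp)) (sym (cong (σ ⟨$⟩ʳ_) (transpose-other k≢x k≢y)))
      where
      apart : Tri (k Fin.< y) (toℕ k ≡ toℕ y) (y Fin.< k) → k Fin.< y ⊎ y Fin.< k
      apart (tri< k<y _ _) = inj₁ k<y
      apart (tri≈ _ k≡y _) = contradiction (Finₚ.toℕ-injective k≡y) k≢y
      apart (tri> _ _ y<k) = inj₂ y<k
cycle-≤ᴮ {n} (suc m) π σ x y z z≡y+1+m x<y outside at-x inside at-z inv =
    -- After this interchange z holds its value under π, while x holds σ(z), which exceeds the value
    -- at w = z - 1. So x and w form the next inversion.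
    reduce x z x<z inv
      (cycle-≤ᴮ m π σ′ x y w w≡y+m x<y outside′ (trans at-x (sym (σ′≡σ y (Finₚ.<⇒≢ x<y ∘ sym) (Finₚ.<⇒≢ y<z))))
        inside′ (trans (proj₁ z-step) (sym σ′-x)) (subst₂ Fin._<_ (sym (σ′≡σ w w≢x w≢z)) (sym σ′-x) (proj₂ z-step)))
  where
  σ′ = interchange x z σ
  z≡1+y+m : toℕ z ≡ suc (toℕ y + m)
  z≡1+y+m = trans z≡y+1+m (+-suc (toℕ y) m)
  w : Fin n
  w = fromℕ< {toℕ y + m} (<-trans (≤-reflexive (sym z≡1+y+m)) (Finₚ.toℕ<n z))
  w≡y+m : toℕ w ≡ toℕ y + m
  w≡y+m = Finₚ.toℕ-fromℕ< _
  z≡1+w : toℕ z ≡ suc (toℕ w)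
  z≡1+w = trans z≡1+y+m (cong suc (sym w≡y+m))
  w<z : w Fin.< z
  w<z = ≤-reflexive (sym z≡1+w)
  y≤w : y Fin.≤ w
  y≤w = ≤-trans (m≤m+n (toℕ y) m) (≤-reflexive (sym w≡y+m))
  y<z : y Fin.< z
  y<z = ≤-<-trans y≤w w<z
  x<z : x Fin.< z
  x<z = <-trans x<y y<z
  w≢x : w ≢ x
  w≢x refl = <⇒≱ x<y y≤w
  w≢z : w ≢ z
  w≢z = Finₚ.<⇒≢ w<z
  σ′-x : σ′ ⟨$⟩ʳ x ≡ σ ⟨$⟩ʳ z
  σ′-x = cong (σ ⟨$⟩ʳ_) (transpose-first x z)
  σ′≡σ : ∀ k → k ≢ x → k ≢ z → σ′ ⟨$⟩ʳ k ≡ σ ⟨$⟩ʳ k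
  σ′≡σ k k≢x k≢z = cong (σ ⟨$⟩ʳ_) (transpose-other k≢x k≢z)
  z-step : π ⟨$⟩ʳ w ≡ σ ⟨$⟩ʳ z × σ ⟨$⟩ʳ w Fin.< σ ⟨$⟩ʳ z
  z-step = inside w z z≡1+w y≤w ≤-refl
  outside′ : ∀ k → k ≢ x → k Fin.< y ⊎ w Fin.< k → π ⟨$⟩ʳ k ≡ σ′ ⟨$⟩ʳ k
  outside′ k k≢x (inj₁ k<y) =
    trans (outside k k≢x (inj₁ k<y)) (sym (σ′≡σ k k≢x (Finₚ.<⇒≢ (<-trans k<y y<z))))
  outside′ k k≢x (inj₂ w<k) with k Finₚ.≟ z
  ... | yes refl = trans at-z (sym (cong (σ ⟨$⟩ʳ_) (transpose-second x z)))
  ... | no  k≢z  = trans (outside k k≢x (inj₂ z<k)) (sym (σ′≡σ k k≢x k≢z))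
    where
    z<k : z Fin.< k
    z<k = ≤∧≢⇒< (subst (_≤ toℕ k) (sym z≡1+w) w<k) (k≢z ∘ sym ∘ Finₚ.toℕ-injective)
  inside′ : ∀ k l → toℕ l ≡ suc (toℕ k) → y Fin.≤ k → l Fin.≤ w →
            π ⟨$⟩ʳ k ≡ σ′ ⟨$⟩ʳ l × σ′ ⟨$⟩ʳ k Fin.< σ′ ⟨$⟩ʳ l
  inside′ k l l≡1+k y≤k l≤w = let πk≡σl , σk<σl = inside k l l≡1+k y≤k (≤-trans l≤w (<⇒≤ w<z)) in
      trans πk≡σl (sym σ′l≡σl) , subst₂ Fin._<_ (sym σ′k≡σk) (sym σ′l≡σl) σk<σl
    where
    k<l : k Fin.< l
    k<l = ≤-reflexive (sym l≡1+k)
    k<z : k Fin.< z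
    k<z = <-≤-trans k<l (≤-trans l≤w (<⇒≤ w<z))
    x<k : x Fin.< k
    x<k = <-≤-trans x<y y≤k
    σ′l≡σl = σ′≡σ l (Finₚ.<⇒≢ (<-trans x<k k<l) ∘ sym) (Finₚ.<⇒≢ (≤-<-trans l≤w w<z))
    σ′k≡σk = σ′≡σ k (Finₚ.<⇒≢ x<k ∘ sym) (Finₚ.<⇒≢ k<z)

-- Common core of the two ways to shorten the first block: its entry at x goes to the end of the
-- second block, whose entries each move one place to the left, the smallest one into x. The data of
-- `cycle-≤ᴮ` become numerical equations between two `block` functions.
right-cycle-≤ᴮ : ∀ {n} a r s a′ r′ {x} {π σ : 𝔖 n} → a + suc r + suc s ≤ n →
                 Shape a′ r′ (suc s) π → Shape a (suc r) (suc s) σ → x < a + suc r →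
                 (∀ k → k ≢ x → k < a + suc r →
                    block a′ r′ (suc s) k ≡ block a (suc r) (suc s) k) →
                 block a′ r′ (suc s) x ≡ a →
                 (∀ j → j < s → block a′ r′ (suc s) (a + suc r + j) ≡ a + suc j) →
                 block a′ r′ (suc s) (a + suc r + s) ≡ block a (suc r) (suc s) x →
                 (∀ k → a + suc r + s < k → block a′ r′ (suc s) k ≡ k) →
                 a + s < block a (suc r) (suc s) x → π ≤ᴮ σ
right-cycle-≤ᴮ {n} a r s a′ r′ {x} {π} {σ} le π-shape σ-shape x<y before at-x inside at-z after inv =
    cycle-≤ᴮ s π σ X Y Z (trans Z≡z (cong (_+ s) (sym Y≡y))) (subst₂ _<_ (sym X≡x) (sym Y≡y) x<y)
      outsideᶠ (agree X Y (trans (B′-at X≡x at-x) (sym (B-at Y≡y B-y)))) insideᶠ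
      (agree Z X (trans (B′-at Z≡z at-z) (sym (B-at X≡x refl))))
      (subst₂ _<_ (sym (trans (value σ-shape Z) (B-at Z≡z (block-right a (n<1+n s)))))
         (sym (trans (value σ-shape X) (B-at X≡x refl))) inv)
  where
  B B′ : ℕ → ℕ
  B = block a (suc r) (suc s)
  B′ = block a′ r′ (suc s)
  z<n : a + suc r + s < n
  z<n = ≤-trans (≤-reflexive (sym (+-suc _ s))) le
  y<n : a + suc r < n
  y<n = ≤-<-trans (m≤m+n _ s) z<n
  X Y Z : Fin n
  X = fromℕ< (<-trans x<y y<n)
  Y = fromℕ< y<n
  Z = fromℕ< z<n
  X≡x : toℕ X ≡ x
  X≡x = Finₚ.toℕ-fromℕ< _
  Y≡y : toℕ Y ≡ a + suc r
  Y≡y = Finₚ.toℕ-fromℕ< _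
  Z≡z : toℕ Z ≡ a + suc r + s
  Z≡z = Finₚ.toℕ-fromℕ< _
  B-at : ∀ {i k v} → toℕ i ≡ k → B k ≡ v → B (toℕ {n} i) ≡ v
  B-at i≡k = trans (cong B i≡k)
  B′-at : ∀ {i k v} → toℕ i ≡ k → B′ k ≡ v → B′ (toℕ {n} i) ≡ v
  B′-at i≡k = trans (cong B′ i≡k)
  B-y : B (a + suc r) ≡ a
  B-y = trans (cong B (sym (+-identityʳ _))) (trans (block-right a z<s) (+-identityʳ a))
  agree : ∀ k l → B′ (toℕ k) ≡ B (toℕ l) → π ⟨$⟩ʳ k ≡ σ ⟨$⟩ʳ l
  agree k l eq = Finₚ.toℕ-injective (trans (value π-shape k) (trans eq (sym (value σ-shape l))))
  outsideᶠ : ∀ k → k ≢ X → k Fin.< Y ⊎ Z Fin.< k → π ⟨$⟩ʳ k ≡ σ ⟨$⟩ʳ k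
  outsideᶠ k k≢X (inj₁ k<Y) = agree k k (before (toℕ k)
    (λ k≡x → k≢X (Finₚ.toℕ-injective (trans k≡x (sym X≡x)))) (subst (toℕ k <_) Y≡y k<Y))
  outsideᶠ k k≢X (inj₂ Z<k) = agree k k (trans (after (toℕ k) z<k)
      (sym (block-above a (subst (_≤ toℕ k) (sym (+-suc _ s)) z<k))))
    where
    z<k = subst (_< toℕ k) Z≡z Z<k
  insideᶠ : ∀ k l → toℕ l ≡ suc (toℕ k) → Y Fin.≤ k → l Fin.≤ Z →
            π ⟨$⟩ʳ k ≡ σ ⟨$⟩ʳ l × σ ⟨$⟩ʳ k Fin.< σ ⟨$⟩ʳ l
  insideᶠ k l l≡1+k Y≤k l≤Z with m≤n⇒∃[o]m+o≡n (subst (_≤ toℕ k) Y≡y Y≤k)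
  ... | j , y+j≡k =
      agree k l (trans (B′-at (sym y+j≡k) (inside j j<s)) (sym (B-at l≡y+1+j (block-right a (s<s j<s)))))
      , subst₂ _<_ (sym (trans (value σ-shape k) (B-at (sym y+j≡k) (block-right a (m<n⇒m<1+n j<s)))))
          (sym (trans (value σ-shape l) (B-at l≡y+1+j (block-right a (s<s j<s)))))
          (+-monoʳ-< a (n<1+n j))
    where
    l≡y+1+j : toℕ l ≡ a + suc r + suc j
    l≡y+1+j = trans l≡1+k (trans (cong suc (sym y+j≡k)) (sym (+-suc _ j)))
    j<s : j < s
    j<s = +-cancelˡ-≤ (a + suc r) _ _ (subst₂ _≤_ l≡y+1+j Z≡z l≤Z)

-- The last entry of the first block is a + suc s + r, which is also the number of the last position
-- of the second block; moved there, it becomes a fixed point.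
shrink-first : ∀ {n} a r s {π σ : 𝔖 n} → a + suc r + suc s ≤ n →
               Shape a r (suc s) π → Shape a (suc r) (suc s) σ → π ≤ᴮ σ
shrink-first a r s le π-shape σ-shape =
    right-cycle-≤ᴮ a r s a r le π-shape σ-shape (≤-reflexive (sym (+-suc a r))) before
      (trans (cong (block a r (suc s)) (sym (+-identityʳ _))) (trans (block-right a z<s) (+-identityʳ a)))
      (λ j j<s → trans (cong (block a r (suc s)) (position a r j)) (block-right a (s<s j<s)))
      (trans (block-above a (≤-reflexive (position′ a r s))) (trans (last a r s) (sym (block-left a (n<1+n r)))))
      (λ k z<k → block-above a (≤-trans (≤-reflexive (position′ a r s)) (<⇒≤ z<k)))
      (subst (a + s <_) (sym (block-left a (n<1+n r))) (≤-trans (≤-reflexive (sym (+-suc a s))) (m≤m+n _ r)))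
  where
  position : ∀ a r j → a + suc r + j ≡ a + r + suc j
  position = solve-∀
  position′ : ∀ a r s → a + r + suc s ≡ a + suc r + s
  position′ = solve-∀
  last : ∀ a r s → a + suc r + s ≡ a + suc s + r
  last = solve-∀
  before : ∀ k → k ≢ a + r → k < a + suc r → block a r (suc s) k ≡ block a (suc r) (suc s) k
  before k k≢ k<y with region a r (suc s) k
  ... | below k<a   = trans (block-below k<a) (sym (block-below k<a))
  ... | left j<r    = trans (block-left a j<r) (sym (block-left a (m<n⇒m<1+n j<r)))
  ... | right {zero}  _ = contradiction (+-identityʳ _) k≢
  ... | right {suc j} _ = contradiction (m≤m+n _ j) (<⇒≱ (subst (_< a + suc r) (sym (position a r j)) k<y))
  ... | above le    = contradiction (≤-trans (m≤m+n _ s) (≤-trans (≤-reflexive (sym (position′ a r s))) le)) (<⇒≱ k<y)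

-- Here x is the first position a of the first block. It receives the smallest entry a of the second
-- block and becomes a fixed point.
shift-first : ∀ {n} a r s {π σ : 𝔖 n} → a + suc r + suc s ≤ n →
              Shape (suc a) r (suc s) π → Shape a (suc r) (suc s) σ → π ≤ᴮ σ
shift-first a r s le π-shape σ-shape =
    right-cycle-≤ᴮ a r s (suc a) r le π-shape σ-shape (m<m+n a z<s) before (block-below (n<1+n a))
      (λ j j<s → trans (cong (block (suc a) r (suc s)) (cong (_+ j) (+-suc a r)))
                   (trans (block-right (suc a) (m<n⇒m<1+n j<s)) (sym (+-suc a j))))
      (trans (cong (block (suc a) r (suc s)) (cong (_+ s) (+-suc a r)))
         (trans (block-right (suc a) (n<1+n s)) (trans (sym (+-suc a s)) (sym first))))
      (λ k z<k → block-above (suc a) (≤-trans (≤-reflexive (position a r s)) z<k))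
      (subst (a + s <_) (sym first) (≤-reflexive (sym (+-suc a s))))
  where
  position : ∀ a r s → suc a + r + suc s ≡ suc (a + suc r + s)
  position = solve-∀
  value-left : ∀ a s j → suc a + suc s + j ≡ a + suc s + suc j
  value-left = solve-∀
  first : block a (suc r) (suc s) a ≡ a + suc s
  first = trans (cong (block a _ _) (sym (+-identityʳ a))) (trans (block-left a z<s) (+-identityʳ _))
  before : ∀ k → k ≢ a → k < a + suc r → block (suc a) r (suc s) k ≡ block a (suc r) (suc s) k
  before k k≢ k<y with region a (suc r) (suc s) k
  ... | below k<a       = trans (block-below (m<n⇒m<1+n k<a)) (sym (block-below k<a))
  ... | left {zero} _   = contradiction (+-identityʳ a) k≢
  ... | left {suc j} 1+j<1+r = trans (cong (block (suc a) r (suc s)) (+-suc a j))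
      (trans (block-left (suc a) (s<s⁻¹ 1+j<1+r)) (trans (value-left a s j) (sym (block-left a 1+j<1+r))))
  ... | right _         = contradiction (m≤m+n _ _) (<⇒≱ k<y)
  ... | above le        = contradiction (m+n≤o⇒m≤o _ le) (<⇒≱ k<y)

shrink-second : ∀ {n} a r s {π σ : 𝔖 n} → a + suc r + suc s ≤ n →
                Shape a (suc r) s π → Shape a (suc r) (suc s) σ → π ≤ᴮ σ
shrink-second {n} a r s {π} {σ} le π-shape σ-shape =
    ≤ᴮ-flip (shrink-first a s r (subst (_≤ n) (+-swap a (suc r) (suc s)) le)
      (shape-flip π π-shape) (shape-flip σ σ-shape))

-- Read from σ downwards, the chain consists of i shifts, j shortenings of the first block and k of
-- the second, through the block interchanges with the intermediate parameters.
family-≤ᴮ : ∀ {n} i j k {a r s} {π σ : 𝔖 n} → a + (i + (j + suc r)) + (k + suc s) ≤ n →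
            Shape (i + a) (suc r) (suc s) π → Shape a (i + (j + suc r)) (k + suc s) σ → π ≤ᴮ σ
family-≤ᴮ zero zero zero {π = π} {σ} le π-shape σ-shape = done (shape-≈ π-shape σ-shape)
family-≤ᴮ {n} (suc i) j k {a} {r} {s} {π} le π-shape σ-shape =
    ≤ᴮ-trans (family-≤ᴮ i j k le₁ (subst (λ b → Shape b (suc r) (suc s) π) (sym (+-suc i a)) π-shape) τ-shape)
      (shift-first′ k le τ-shape σ-shape)
  where
  le₁ : suc a + (i + (j + suc r)) + (k + suc s) ≤ n
  le₁ = subst (_≤ n) (cong (_+ (k + suc s)) (+-suc a _)) le
  τ-shape = block-perm-shape (suc a) (i + (j + suc r)) (k + suc s) le₁
  shift-first′ : ∀ k {π σ : 𝔖 n} → a + suc (i + (j + suc r)) + (k + suc s) ≤ n →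
                 Shape (suc a) (i + (j + suc r)) (k + suc s) π →
                 Shape a (suc (i + (j + suc r))) (k + suc s) σ → π ≤ᴮ σ
  -- `shift-first` asks for a successor as second length, and k + suc s becomes one by this
  -- rewriting.
  shift-first′ k rewrite +-suc k s = shift-first a _ _
family-≤ᴮ {n} zero (suc j) k {a} {r} {s} le π-shape σ-shape =
    ≤ᴮ-trans (family-≤ᴮ zero j k le₁ π-shape τ-shape) (shrink-first′ k le τ-shape σ-shape)
  where
  le₁ : a + (j + suc r) + (k + suc s) ≤ n
  le₁ = ≤-trans (+-monoˡ-≤ (k + suc s) (+-monoʳ-≤ a (n≤1+n _))) le
  τ-shape = block-perm-shape a (j + suc r) (k + suc s) le₁
  shrink-first′ : ∀ k {π σ : 𝔖 n} → a + suc (j + suc r) + (k + suc s) ≤ n →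
                  Shape a (j + suc r) (k + suc s) π →
                  Shape a (suc (j + suc r)) (k + suc s) σ → π ≤ᴮ σ
  shrink-first′ k rewrite +-suc k s = shrink-first a _ _
family-≤ᴮ {n} zero zero (suc k) {a} {r} {s} le π-shape σ-shape =
    ≤ᴮ-trans (family-≤ᴮ zero zero k le₁ π-shape τ-shape) (shrink-second a r _ le τ-shape σ-shape)
  where
  le₁ : a + suc r + (k + suc s) ≤ n
  le₁ = ≤-trans (+-monoʳ-≤ (a + suc r) (n≤1+n _)) le
  τ-shape = block-perm-shape a (suc r) (k + suc s) le₁

-- Classification of the bigrassmannian permutations

-- With its converse `length-filter-∃!`, this trades the descent counts in `Bigrassmannian` for
-- unique existence.
∃!-length-filter : ∀ {n} {P : Pred (Fin n) 0ℓ} (P? : Decidable P) →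
                   length (filter P? (allFin n)) ≡ 1 → ∃[ p ] (P p × (∀ i → P i → i ≡ p))
∃!-length-filter {n} P? eq with filter P? (allFin n) in filter-eq
... | p ∷ [] = p , proj₂ (∈-filter⁻ P? {xs = allFin n} (subst (p ∈_) (sym filter-eq) (here refl))) , only
  where
  only : ∀ i → _ → i ≡ p
  only i Pi with subst (i ∈_) filter-eq (∈-filter⁺ P? (∈-allFin i) Pi)
  ... | here i≡p = i≡p

length-filter-∃! : ∀ {n} {P : Pred (Fin n) 0ℓ} (P? : Decidable P) p →
                   P p → (∀ i → P i → i ≡ p) → length (filter P? (allFin n)) ≡ 1
length-filter-∃! {n} {P} P? p Pp only
  with filter P? (allFin n) in filter-eq | Uniqueₚ.filter⁺ P? (Uniqueₚ.allFin⁺ n)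
... | [] | _ with () ← subst (p ∈_) filter-eq (∈-filter⁺ P? (∈-allFin p) Pp)
... | _ ∷ [] | _ = refl
... | i ∷ j ∷ _ | (i≢j ∷ _) ∷ _ =
  contradiction (trans (only i (satisfies (here refl))) (sym (only j (satisfies (there (here refl)))))) i≢j
  where
  satisfies : ∀ {k} → k ∈ i ∷ j ∷ _ → P k
  satisfies {k} k∈ = proj₂ (∈-filter⁻ P? {xs = allFin n} (subst (k ∈_) (sym filter-eq) k∈))

shape⇒#descents≡1 : ∀ {n} a r s (ω : 𝔖 n) → a + suc r + suc s ≤ n →
                    Shape a (suc r) (suc s) ω → #descents ω ≡ 1
shape⇒#descents≡1 {n} a r s ω le ω-shape =
    length-filter-∃! (descent? ω) p (p⁺ , trans p⁺≡1+a+r (cong suc (sym p≡a+r)) , drop) only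
  where
  1+a+r<n : suc (a + r) < n
  1+a+r<n = ≤-trans (s≤s (≤-reflexive (sym (+-suc a r)))) (≤-trans (m<m+n _ z<s) le)
  p p⁺ : Fin n
  p = fromℕ< (<-trans (n<1+n _) 1+a+r<n)
  p⁺ = fromℕ< 1+a+r<n
  p≡a+r : toℕ p ≡ a + r
  p≡a+r = Finₚ.toℕ-fromℕ< _
  p⁺≡1+a+r : toℕ p⁺ ≡ suc (a + r)
  p⁺≡1+a+r = Finₚ.toℕ-fromℕ< _
  value-at : ∀ {i k} → toℕ i ≡ k → block a (suc r) (suc s) k ≡ toℕ (ω ⟨$⟩ʳ i)
  value-at i≡k = trans (cong (block a _ _) (sym i≡k)) (sym (value ω-shape _))
  drop : ω ⟨$⟩ʳ p⁺ Fin.< ω ⟨$⟩ʳ p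
  drop = subst₂ _<_ (value-at p⁺≡1+a+r) (value-at p≡a+r) (block-drop a r s)
  only : ∀ i → Descent ω i → i ≡ p
  only i (j , j≡1+i , ωj<ωi) with toℕ i ≟ a + r
  ... | yes i≡a+r = Finₚ.toℕ-injective (trans i≡a+r (sym p≡a+r))
  ... | no  i≢a+r = contradiction ωj<ωi
      (<-asym (subst₂ _<_ (value-at refl) (value-at j≡1+i) (block-step a r (suc s) (toℕ i) i≢a+r)))

shape⇒bigrassmannian : ∀ {n} a r s (ω : 𝔖 n) → a + suc r + suc s ≤ n →
                       Shape a (suc r) (suc s) ω → Bigrassmannian ω
shape⇒bigrassmannian {n} a r s ω le ω-shape =
    shape⇒#descents≡1 a r s ω le ω-shape
  , shape⇒#descents≡1 a s r (flip ω) (subst (_≤ n) (+-swap a (suc r) (suc s)) le) (shape-flip ω ω-shape)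

perm-injective : ∀ {n} (ω : 𝔖 n) {i j} → ω ⟨$⟩ʳ i ≡ ω ⟨$⟩ʳ j → i ≡ j
perm-injective ω eq = trans (sym (Perm.inverseˡ ω)) (trans (cong (ω ⟨$⟩ˡ_) eq) (Perm.inverseˡ ω))

-- Growth on either side of a unique descent

record UniqueDescent {n} (ω : 𝔖 n) : Set where
  field
    p p⁺   : Fin n
    p⁺≡1+p : toℕ p⁺ ≡ suc (toℕ p)
    drop   : ω ⟨$⟩ʳ p⁺ Fin.< ω ⟨$⟩ʳ p
    only   : ∀ i → Descent ω i → i ≡ p

  p<p⁺ : p Fin.< p⁺
  p<p⁺ = ≤-reflexive (sym p⁺≡1+p)

  -- Each step away from p raises the value by at least one, since it is not a descent and ω is
  -- injective. The disjunction keeps the interval from i to j on one side of the descent.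
  grows : ∀ m {i j} → toℕ j ≡ toℕ i + m → p Fin.< i ⊎ j Fin.≤ p →
          toℕ (ω ⟨$⟩ʳ i) + m ≤ toℕ (ω ⟨$⟩ʳ j)
  grows zero {i} {j} j≡i+0 _ with Finₚ.toℕ-injective (trans j≡i+0 (+-identityʳ _))
  ... | refl = ≤-reflexive (+-identityʳ _)
  grows (suc m) {i} {j} j≡i+1+m side = begin
      toℕ (ω ⟨$⟩ʳ i) + suc m     ≡⟨ +-suc _ m ⟩
      suc (toℕ (ω ⟨$⟩ʳ i) + m)   ≤⟨ s≤s (grows m k≡i+m side′) ⟩
      suc (toℕ (ω ⟨$⟩ʳ k))       ≤⟨ ωk<ωj ⟩
      toℕ (ω ⟨$⟩ʳ j)             ∎
    where
    open ≤-Reasoning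
    j≡1+i+m : toℕ j ≡ suc (toℕ i + m)
    j≡1+i+m = trans j≡i+1+m (+-suc (toℕ i) m)
    k : Fin n
    k = fromℕ< {toℕ i + m} (<-trans (≤-reflexive (sym j≡1+i+m)) (Finₚ.toℕ<n j))
    k≡i+m : toℕ k ≡ toℕ i + m
    k≡i+m = Finₚ.toℕ-fromℕ< _
    j≡1+k : toℕ j ≡ suc (toℕ k)
    j≡1+k = trans j≡1+i+m (cong suc (sym k≡i+m))
    k<j : k Fin.< j
    k<j = ≤-reflexive (sym j≡1+k)
    i≤k : i Fin.≤ k
    i≤k = subst (toℕ i ≤_) (sym k≡i+m) (m≤m+n _ m)
    side′ : p Fin.< i ⊎ k Fin.≤ p
    side′ = map₂ (≤-trans (<⇒≤ k<j)) side
    k≢p : k ≢ p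
    k≢p k≡p = [ (λ p<i → <⇒≱ p<i (subst (i Fin.≤_) k≡p i≤k))
              , (λ j≤p → <⇒≱ (subst (Fin._< j) k≡p k<j) j≤p) ]′ side
    ωk<ωj : ω ⟨$⟩ʳ k Fin.< ω ⟨$⟩ʳ j
    ωk<ωj = ≰⇒> λ ωj≤ωk → k≢p (only k (j , j≡1+k ,
      ≤∧≢⇒< ωj≤ωk λ eq → Finₚ.<⇒≢ k<j (sym (perm-injective ω (Finₚ.toℕ-injective eq)))))

  increasing : ∀ {i j} → i Fin.< j → p Fin.< i ⊎ j Fin.≤ p → ω ⟨$⟩ʳ i Fin.< ω ⟨$⟩ʳ j
  increasing i<j side with m≤n⇒∃[o]m+o≡n i<j
  ... | m , 1+i+m≡j = ≤-trans
    (≤-trans (≤-reflexive (+-comm 1 _)) (+-monoʳ-≤ _ (s≤s (z≤n {m}))))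
    (grows (suc m) (trans (sym 1+i+m≡j) (sym (+-suc _ m))) side)

  ≤-value : ∀ i → i Fin.≤ p → toℕ i ≤ toℕ (ω ⟨$⟩ʳ i)
  ≤-value i@zero     _   = z≤n
  ≤-value i@(suc i′) i≤p = ≤-trans (m≤n+m _ _) (grows (toℕ i) {zero} {i} refl (inj₂ i≤p))

  value-≤ : ∀ i → p Fin.< i → toℕ (ω ⟨$⟩ʳ i) ≤ toℕ i
  value-≤ i p<i = +-cancelʳ-≤ m _ _ (≤-trans (grows m last≡i+m (inj₁ p<i))
      (≤-trans (Finₚ.toℕ≤pred[n] (ω ⟨$⟩ʳ last)) (≤-reflexive (trans (sym last≡n-1) last≡i+m))))
    where
    last : Fin n
    -- As n is not given as a successor, the last position is the opposite of position 0, which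
    -- exists because i does.
    last = Fin.opposite (fromℕ< (≤-<-trans z≤n (Finₚ.toℕ<n i)))
    last≡n-1 : toℕ last ≡ n ∸ 1
    last≡n-1 = trans (Finₚ.opposite-prop (fromℕ< (≤-<-trans z≤n (Finₚ.toℕ<n i))))
      (cong (λ k → n ∸ suc k) (Finₚ.toℕ-fromℕ< (≤-<-trans z≤n (Finₚ.toℕ<n i))))
    m : ℕ
    m = (n ∸ 1) ∸ toℕ i
    last≡i+m : toℕ last ≡ toℕ i + m
    last≡i+m = trans last≡n-1 (sym (m+[n∸m]≡n (Finₚ.toℕ≤pred[n] i)))

uniqueDescent : ∀ {n} (ω : 𝔖 n) → #descents ω ≡ 1 → UniqueDescent ω
uniqueDescent ω eq with ∃!-length-filter (descent? ω) eq
... | p , (p⁺ , p⁺≡1+p , drop) , only =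
  record { p = p ; p⁺ = p⁺ ; p⁺≡1+p = p⁺≡1+p ; drop = drop ; only = only }

module Cuts {n} (ω : 𝔖 n) (D : UniqueDescent ω) (D⁻¹ : UniqueDescent (flip ω)) where
  open UniqueDescent D
  open UniqueDescent D⁻¹ using () renaming
    ( p to q; p⁺ to q⁺; p⁺≡1+p to q⁺≡1+q; p<p⁺ to q<q⁺; drop to drop⁻¹; grows to grows⁻¹
    ; ≤-value to ≤-value⁻¹; value-≤ to value-≤⁻¹)

  -- The values q and q⁺ are consecutive but appear in the wrong order: q⁺ opens the first block, at
  -- A, and q closes the second, at C.
  A C : Fin n
  A = ω ⟨$⟩ˡ q⁺
  C = ω ⟨$⟩ˡ q

  -- A precedes C but holds the larger value, so the descent p must separate them.
  ¬increasing-A-C : ¬ (p Fin.< A ⊎ C Fin.≤ p)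
  ¬increasing-A-C side = <-asym q<q⁺
    (subst₂ Fin._<_ (Perm.inverseʳ ω) (Perm.inverseʳ ω) (increasing drop⁻¹ side))

  A≤p : A Fin.≤ p
  A≤p = ≮⇒≥ (¬increasing-A-C ∘ inj₁)

  p<C : p Fin.< C
  p<C = ≰⇒> (¬increasing-A-C ∘ inj₂)

  -- Positions before A hold values at most q. So i and ω(i) are on the left of the descents of ω
  -- and of its inverse, where neither map lowers its argument.
  fixed-below : ∀ i → i Fin.< A → toℕ (ω ⟨$⟩ʳ i) ≡ toℕ i
  fixed-below i i<A = ≤-antisym
      (subst (toℕ (ω ⟨$⟩ʳ i) ≤_) (cong toℕ (Perm.inverseˡ ω)) (≤-value⁻¹ (ω ⟨$⟩ʳ i) ωi≤q))
      (≤-value i (≤-trans (<⇒≤ i<A) A≤p))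
    where
    ωi≤q : ω ⟨$⟩ʳ i Fin.≤ q
    ωi≤q = s≤s⁻¹ (subst (toℕ (ω ⟨$⟩ʳ i) <_) (trans (cong toℕ (Perm.inverseʳ ω)) q⁺≡1+q)
      (increasing i<A (inj₂ A≤p)))

  -- Growth of ω from A bounds the value from below. Growth of the inverse from q⁺ bounds the
  -- position from below in terms of the value, hence the value from above.
  shifted : ∀ m i → toℕ i ≡ toℕ A + m → i Fin.≤ p → toℕ (ω ⟨$⟩ʳ i) ≡ toℕ q⁺ + m
  shifted m i i≡A+m i≤p = ≤-antisym upper lower
    where
    lower : toℕ q⁺ + m ≤ toℕ (ω ⟨$⟩ʳ i)
    lower = subst (λ v → toℕ v + m ≤ toℕ (ω ⟨$⟩ʳ i)) (Perm.inverseʳ ω) (grows m i≡A+m (inj₂ i≤p))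
    upper : toℕ (ω ⟨$⟩ʳ i) ≤ toℕ q⁺ + m
    upper with m≤n⇒∃[o]m+o≡n (m+n≤o⇒m≤o _ lower)
    ... | m′ , q⁺+m′≡ωi = subst (_≤ toℕ q⁺ + m) q⁺+m′≡ωi (+-monoʳ-≤ (toℕ q⁺)
      (+-cancelˡ-≤ (toℕ A) _ _ (subst (toℕ A + m′ ≤_) (trans (cong toℕ (Perm.inverseˡ ω)) i≡A+m)
        (grows⁻¹ m′ (sym q⁺+m′≡ωi) (inj₁ q<q⁺)))))

  fixed-above : ∀ i → p Fin.< i → q Fin.< ω ⟨$⟩ʳ i → toℕ (ω ⟨$⟩ʳ i) ≡ toℕ i
  fixed-above i p<i q<ωi = ≤-antisym (value-≤ i p<i)
    (subst (λ j → toℕ j ≤ toℕ (ω ⟨$⟩ʳ i)) (Perm.inverseˡ ω) (value-≤⁻¹ (ω ⟨$⟩ʳ i) q<ωi))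

  -- Otherwise ω(p⁺) would be a fixed point below A, and injectivity would put p⁺ itself below A.
  A≤ωp⁺ : A Fin.≤ ω ⟨$⟩ʳ p⁺
  A≤ωp⁺ = ≮⇒≥ λ ωp⁺<A → <⇒≱ (subst (Fin._< A)
    (perm-injective ω (Finₚ.toℕ-injective (fixed-below _ ωp⁺<A))) ωp⁺<A) (≤-trans A≤p (<⇒≤ p<p⁺))

bigrassmannian⇒shape : ∀ {n} (ω : 𝔖 n) → Bigrassmannian ω →
  ∃[ a ] ∃[ r ] ∃[ s ] (a + suc r + suc s ≤ n × Shape a (suc r) (suc s) ω)
bigrassmannian⇒shape {n} ω (#D≡1 , #D⁻¹≡1) = a , r , s , le , shape λ i → value-at (region a _ _ _) i refl
  where
  D = uniqueDescent ω #D≡1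
  D⁻¹ = uniqueDescent (flip ω) #D⁻¹≡1
  open UniqueDescent D using (p; p⁺; p⁺≡1+p; increasing)
  open UniqueDescent D⁻¹ using () renaming (p to q; p⁺ to q⁺; p⁺≡1+p to q⁺≡1+q)
  open Cuts ω D D⁻¹
  module Flip = Cuts (flip ω) D⁻¹ D
  a r s : ℕ
  a = toℕ A
  -- The first block occupies the positions from A to p and the second takes the values from a to q,
  -- so r and s are the lengths minus one.
  r = toℕ p ∸ a
  s = toℕ q ∸ a
  a≡ωp⁺ : a ≡ toℕ (ω ⟨$⟩ʳ p⁺)
  -- `Flip.A` is ω(p⁺) and the inverse sends q⁺ to A, so the same lemma for the inverse is the
  -- reverse inequality.
  a≡ωp⁺ = ≤-antisym A≤ωp⁺ Flip.A≤ωp⁺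
  p≡a+r : toℕ p ≡ a + r
  p≡a+r = sym (m+[n∸m]≡n A≤p)
  q≡a+s : toℕ q ≡ a + s
  q≡a+s = sym (m+[n∸m]≡n (subst (_≤ toℕ q) (sym a≡ωp⁺) Flip.A≤p))
  p⁺≡a+1+r : toℕ p⁺ ≡ a + suc r
  p⁺≡a+1+r = trans p⁺≡1+p (trans (cong suc p≡a+r) (sym (+-suc a r)))
  q⁺≡a+1+s : toℕ q⁺ ≡ a + suc s
  q⁺≡a+1+s = trans q⁺≡1+q (trans (cong suc q≡a+s) (sym (+-suc a s)))
  shifted⁻¹ : ∀ {j} v → toℕ v ≡ a + j → v Fin.≤ q → toℕ (ω ⟨$⟩ˡ v) ≡ a + suc r + j
  shifted⁻¹ {j} v v≡a+j v≤q =
    trans (Flip.shifted j v (trans v≡a+j (cong (_+ j) a≡ωp⁺)) v≤q) (cong (_+ j) p⁺≡a+1+r)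
  C≡a+1+r+s : toℕ C ≡ a + suc r + s
  C≡a+1+r+s = shifted⁻¹ q q≡a+s ≤-refl
  le : a + suc r + suc s ≤ n
  le = subst (_≤ n) (trans (cong suc C≡a+1+r+s) (sym (+-suc _ s))) (Finₚ.toℕ<n C)
  value-at : ∀ {k} → Region a (suc r) (suc s) k → ∀ i → toℕ i ≡ k →
             toℕ (ω ⟨$⟩ʳ i) ≡ block a (suc r) (suc s) k
  value-at (below i<a) i refl = trans (fixed-below i i<a) (sym (block-below i<a))
  value-at (left {j} j<1+r) i i≡a+j = trans
      (trans (shifted j i i≡a+j i≤p) (cong (_+ j) q⁺≡a+1+s)) (sym (block-left a j<1+r))
    where
    i≤p : i Fin.≤ p
    i≤p = subst₂ _≤_ (sym i≡a+j) (sym p≡a+r) (+-monoʳ-≤ a (s≤s⁻¹ j<1+r))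
  -- The second block is read off the inverse, whose value at a + j turns out to be i.
  value-at (right {j} j<1+s) i i≡a+1+r+j = trans
      (trans (cong toℕ (trans (cong (ω ⟨$⟩ʳ_) (sym ω⁻¹v≡i)) (Perm.inverseʳ ω))) v≡a+j)
      (sym (block-right a j<1+s))
    where
    a+j≤q : a + j ≤ toℕ q
    a+j≤q = subst (a + j ≤_) (sym q≡a+s) (+-monoʳ-≤ a (s≤s⁻¹ j<1+s))
    v : Fin n
    v = fromℕ< (≤-<-trans a+j≤q (Finₚ.toℕ<n q))
    v≡a+j : toℕ v ≡ a + j
    v≡a+j = Finₚ.toℕ-fromℕ< _
    ω⁻¹v≡i : ω ⟨$⟩ˡ v ≡ i
    ω⁻¹v≡i = Finₚ.toℕ-injective (trans
      (shifted⁻¹ v v≡a+j (subst (_≤ toℕ q) (sym v≡a+j) a+j≤q)) (sym i≡a+1+r+j))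
  value-at (above le) i refl = trans (fixed-above i (<-trans p<C C<i) q<ωi) (sym (block-above a le))
    where
    C<i : C Fin.< i
    C<i = subst (_≤ toℕ i) (trans (+-suc _ s) (cong suc (sym C≡a+1+r+s))) le
    q<ωi : q Fin.< ω ⟨$⟩ʳ i
    q<ωi = subst (Fin._< ω ⟨$⟩ʳ i) (Perm.inverseʳ ω) (increasing C<i (inj₁ p<C))

-- Counting

Fin*³↔ : ∀ a b c → Fin (a * (b * c)) ↔ (Fin a × Fin b × Fin c)
Fin*³↔ a b c = (↔-id (Fin a) ×-↔ Finₚ.*↔× {b} {c}) ↔-∘ Finₚ.*↔× {a} {b * c}

-- Each key is sent to the position of a related entry. A relation replaces a function because the
-- permutation with a given key is found in the list only up to `≈`.
distinct⇒≤-length : ∀ {A K : Set} {c} {ys : List A} → Fin c ↔ K → (R : K → A → Set) →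
                    (∀ k → ∃[ y ] (y ∈ ys × R k y)) →
                    (∀ {k l y} → R k y → R l y → k ≡ l) → c ≤ length ys
distinct⇒≤-length {A} {K} {c} {ys} keys R witness R-injective =
    Finₚ.injective⇒≤ {f = position ∘ to} λ {i} {j} eq →
      trans (sym (strictlyInverseʳ i))
        (trans (cong from (position-injective (to i) (to j) eq)) (strictlyInverseʳ j))
  where
  open Inverse keys using (to; from; strictlyInverseʳ)
  member : ∀ k → proj₁ (witness k) ∈ ys
  member k = proj₁ (proj₂ (witness k))
  position : K → Fin (length ys)
  position k = Any.index (member k)
  related : ∀ k → R k (lookup ys (position k))
  related k = subst (R k) (Anyₚ.lookup-index (member k)) (proj₂ (proj₂ (witness k)))
  position-injective : ∀ k l → position k ≡ position l → k ≡ l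
  position-injective k l eq =
    R-injective (related k) (subst (λ i → R l (lookup ys i)) (sym eq) (related l))

unique⇒lookup-injective : ∀ {n} {xs : List (𝔖 n)} → Unique.Unique (𝔖-setoid n) xs →
                          ∀ {i j} → lookup xs i ≈ lookup xs j → i ≡ j
unique⇒lookup-injective (_ ∷ _)  {zero}  {zero}  _  = refl
unique⇒lookup-injective (x∉ ∷ _) {zero}  {suc j} eq = contradiction eq (All.lookup x∉ (∈-lookup j))
unique⇒lookup-injective (x∉ ∷ _) {suc i} {zero}  eq = contradiction (λ k → sym (eq k)) (All.lookup x∉ (∈-lookup i))
unique⇒lookup-injective (_ ∷ u)  {suc i} {suc j} eq = cong suc (unique⇒lookup-injective u eq)

-- Positions with the same key hold `≈` permutations, hence coincide in a list without repetitions
-- up to `≈`.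
length-≤-keys : ∀ {n} {K : Set} {c} {xs : List (𝔖 n)} → Fin c ↔ K → (R : K → 𝔖 n → Set) →
                Unique.Unique (𝔖-setoid n) xs →
                (∀ {ω} → ω ∈ xs → ∃[ k ] R k ω) →
                (∀ {k π σ} → R k π → R k σ → π ≈ σ) → length xs ≤ c
length-≤-keys {K = K} {xs = xs} keys R unique key R-functional =
    Finₚ.injective⇒≤ {f = from ∘ code} λ {i} {j} eq →
      unique⇒lookup-injective unique {i} {j} (R-functional (related i)
        (subst (λ k → R k (lookup xs j)) (sym (code-≡ i j eq)) (related j)))
  where
  open Inverse keys using (to; from; strictlyInverseˡ)
  code : Fin (length xs) → K
  code i = proj₁ (key (∈-lookup {xs = xs} i))
  related : ∀ i → R (code i) (lookup xs i)
  related i = proj₂ (key (∈-lookup {xs = xs} i))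
  code-≡ : ∀ i j → from (code i) ≡ from (code j) → code i ≡ code j
  code-≡ i j eq = trans (sym (strictlyInverseˡ (code i))) (trans (cong to eq) (strictlyInverseˡ (code j)))

𝔅-unique : ∀ n → Unique.Unique (𝔖-setoid n) (𝔅 n)
𝔅-unique n = UniqueSetoidₚ.filter⁺ (𝔖-setoid n) bigrassmannian? (permutations-unique n)

∈𝔅⇒shape : ∀ {n} {ω : 𝔖 n} → ω ∈ 𝔅 n →
           ∃[ a ] ∃[ r ] ∃[ s ] (a + suc r + suc s ≤ n × Shape a (suc r) (suc s) ω)
∈𝔅⇒shape {n} {ω} ω∈𝔅 = bigrassmannian⇒shape ω (proj₂ (∈-filter⁻ bigrassmannian? {xs = permutations n} ω∈𝔅))

shape∈𝔅 : ∀ {n} a r s → a + suc r + suc s ≤ n → ∃[ ω ] (ω ∈ 𝔅 n × Shape a (suc r) (suc s) ω)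
-- Completeness of `permutations` yields an entry that agrees pointwise with `block-perm`; this
-- entry is the witness.
shape∈𝔅 {n} a r s le with find (permutations-complete (block-perm a (suc r) (suc s) le))
... | ω , ω∈ , eq = ω , ∈-filter⁺ bigrassmannian? ω∈ (shape⇒bigrassmannian a r s ω le ω-shape) , ω-shape
  where
  ω-shape : Shape a (suc r) (suc s) ω
  ω-shape = shape-respˡ eq (block-perm-shape a (suc r) (suc s) le)

-- This is by definition the number of keys in `Fin*³↔`; n ^ 3 carries a further factor 1.
cube : ℕ → ℕ
cube m = m * (m * m)

a<size : ∀ a r s → a < a + suc r + suc s
a<size a r s = ≤-trans (m<m+n a z<s) (m≤m+n (a + suc r) (suc s))

r<size : ∀ a r s → r < a + suc r + suc s
r<size a r s = ≤-trans (m≤n+m (suc r) a) (m≤m+n (a + suc r) (suc s))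

s<size : ∀ a r s → s < a + suc r + suc s
s<size a r s = m≤n+m (suc s) (a + suc r)

∣𝔅∣≤n³ : ∀ n → length (𝔅 n) ≤ cube n
∣𝔅∣≤n³ n = length-≤-keys {xs = 𝔅 n} (Fin*³↔ n n n) R (𝔅-unique n) (encode ∘ ∈𝔅⇒shape) shape-≈
  where
  R : Fin n × Fin n × Fin n → 𝔖 n → Set
  R (a , r , s) = Shape (toℕ a) (suc (toℕ r)) (suc (toℕ s))
  encode : ∀ {ω} → ∃[ a ] ∃[ r ] ∃[ s ] (a + suc r + suc s ≤ n × Shape a (suc r) (suc s) ω) → ∃[ k ] R k ω
  encode {ω} (a , r , s , le , ω-shape) = (fromℕ< a<n , fromℕ< r<n , fromℕ< s<n) , coded
    where
    a<n : a < n
    a<n = ≤-trans (a<size a r s) le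
    r<n : r < n
    r<n = ≤-trans (r<size a r s) le
    s<n : s < n
    s<n = ≤-trans (s<size a r s) le
    coded : R (fromℕ< a<n , fromℕ< r<n , fromℕ< s<n) ω
    coded rewrite Finₚ.toℕ-fromℕ< a<n | Finₚ.toℕ-fromℕ< r<n | Finₚ.toℕ-fromℕ< s<n = ω-shape

m³≤∣𝔅∣ : ∀ m n → 3 * m ≤ n → cube m ≤ length (𝔅 n)
m³≤∣𝔅∣ m n 3m≤n = distinct⇒≤-length (Fin*³↔ m m m)
    (λ { (a , r , s) → Shape (toℕ a) (suc (toℕ r)) (suc (toℕ s)) })
    (λ { (a , r , s) → shape∈𝔅 (toℕ a) (toℕ r) (toℕ s) (le a r s) })
    (λ { {a , r , s} {a′ , r′ , s′} {ω} ω-shape ω-shape′ →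
      let a≡ , r≡ , s≡ = shape-injective ω (le a r s) (le a′ r′ s′) ω-shape ω-shape′ in
      cong₂ _,_ (Finₚ.toℕ-injective a≡) (cong₂ _,_ (Finₚ.toℕ-injective r≡) (Finₚ.toℕ-injective s≡)) })
  where
  3*≡ : ∀ m → m + m + m ≡ 3 * m
  3*≡ = solve-∀
  le : ∀ (a r s : Fin m) → toℕ a + suc (toℕ r) + suc (toℕ s) ≤ n
  le a r s = ≤-trans (+-mono-≤ (+-mono-≤ (<⇒≤ (Finₚ.toℕ<n a)) (Finₚ.toℕ<n r)) (Finₚ.toℕ<n s))
    (≤-trans (≤-reflexive (3*≡ m)) 3m≤n)

-- The elements below are chosen with short blocks, of lengths suc j and suc k. The differences r -
-- i - j and s - k are then the numbers of plain shortenings in `family-≤ᴮ`.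
e³≤β : ∀ {n} e a r s {ω : 𝔖 n} → a + suc r + suc s ≤ n → Shape a (suc r) (suc s) ω →
       e + e ≤ r → e + e ≤ s → cube e ≤ β ω
e³≤β {n} e a r s {ω} le ω-shape 2e≤r 2e≤s = distinct⇒≤-length (Fin*³↔ e e e)
    (λ { (i , j , k) → Shape (toℕ i + a) (suc (toℕ j)) (suc (toℕ k)) })
    (λ { (i , j , k) → let τ , τ∈𝔅 , τ-shape = shape∈𝔅 (toℕ i + a) (toℕ j) (toℕ k) (le′ i j k) in
      τ , ∈-filter⁺ (_≤ᴮ? ω) τ∈𝔅 (τ≤ω i j k τ-shape) , τ-shape })
    (λ { {i , j , k} {i′ , j′ , k′} {τ} τ-shape τ-shape′ →
      let i≡ , j≡ , k≡ = shape-injective τ (le′ i j k) (le′ i′ j′ k′) τ-shape τ-shape′ in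
      cong₂ _,_ (Finₚ.toℕ-injective (+-cancelʳ-≡ a _ _ i≡))
        (cong₂ _,_ (Finₚ.toℕ-injective j≡) (Finₚ.toℕ-injective k≡)) })
  where
  i+j≤r : ∀ (i j : Fin e) → toℕ i + toℕ j ≤ r
  i+j≤r i j = ≤-trans (+-mono-≤ (<⇒≤ (Finₚ.toℕ<n i)) (<⇒≤ (Finₚ.toℕ<n j))) 2e≤r
  k≤s : ∀ (k : Fin e) → toℕ k ≤ s
  k≤s k = ≤-trans (<⇒≤ (Finₚ.toℕ<n k)) (m+n≤o⇒m≤o e 2e≤s)
  le′ : ∀ (i j k : Fin e) → toℕ i + a + suc (toℕ j) + suc (toℕ k) ≤ n
  le′ i j k = begin
      toℕ i + a + suc (toℕ j) + suc (toℕ k)     ≡⟨ rearrange (toℕ i) a (toℕ j) (toℕ k) ⟩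
      a + suc (toℕ i + toℕ j) + suc (toℕ k)     ≤⟨ +-mono-≤ (+-monoʳ-≤ a (s≤s (i+j≤r i j))) (s≤s (k≤s k)) ⟩
      a + suc r + suc s                         ≤⟨ le ⟩
      n                                         ∎
    where
    open ≤-Reasoning
    rearrange : ∀ i a j k → i + a + suc j + suc k ≡ a + suc (i + j) + suc k
    rearrange = solve-∀
  τ≤ω : ∀ (i j k : Fin e) {τ} → Shape (toℕ i + a) (suc (toℕ j)) (suc (toℕ k)) τ → τ ≤ᴮ ω
  τ≤ω i j k τ-shape with m≤n⇒∃[o]m+o≡n (i+j≤r i j) | m≤n⇒∃[o]m+o≡n (k≤s k)
  ... | j′ , i+j+j′≡r | k′ , k+k′≡s =
      family-≤ᴮ (toℕ i) j′ k′ (subst₂ (λ r s → a + r + s ≤ n) r≡ s≡ le) τ-shape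
        (subst₂ (λ r s → Shape a r s ω) r≡ s≡ ω-shape)
    where
    rearrange : ∀ i j j′ → suc (i + j + j′) ≡ i + (j′ + suc j)
    rearrange = solve-∀
    r≡ : suc r ≡ toℕ i + (j′ + suc (toℕ j))
    r≡ = trans (cong suc (sym i+j+j′≡r)) (rearrange (toℕ i) (toℕ j) j′)
    s≡ : suc s ≡ k′ + suc (toℕ k)
    s≡ = trans (cong suc (trans (sym k+k′≡s) (+-comm (toℕ k) k′))) (sym (+-suc k′ (toℕ k)))

-- Going up, the start moves left by i, which e ≤ a allows, and the end moves right by j + k, which
-- fits into the e + e entries after the blocks.
e³≤α : ∀ {n} e a r s {ω : 𝔖 n} → a + suc r + suc s + (e + e) ≤ n → Shape a (suc r) (suc s) ω →
       e ≤ a → cube e ≤ α ω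
e³≤α {n} e a r s {ω} le ω-shape e≤a = distinct⇒≤-length (Fin*³↔ e e e)
    (λ { (i , j , k) → Shape (a ∸ toℕ i) (suc (toℕ i + toℕ j + r)) (suc (toℕ k + s)) })
    (λ { (i , j , k) → let τ , τ∈𝔅 , τ-shape = shape∈𝔅 _ _ _ (le′ i j k) in
      τ , ∈-filter⁺ (ω ≤ᴮ?_) τ∈𝔅 (ω≤τ i j k τ-shape) , τ-shape })
    (λ { {i , j , k} {i′ , j′ , k′} {τ} τ-shape τ-shape′ →
      let i≡ , r≡ , s≡ = shape-injective τ (le′ i j k) (le′ i′ j′ k′) τ-shape τ-shape′
      in keys-≡ i i′ (∸-cancelˡ-≡ (i≤a i) (i≤a i′) i≡) r≡ s≡ })
  where
  i≤a : ∀ (i : Fin e) → toℕ i ≤ a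
  i≤a i = ≤-trans (<⇒≤ (Finₚ.toℕ<n i)) e≤a
  keys-≡ : ∀ (i i′ : Fin e) {j j′ k k′ : Fin e} → toℕ i ≡ toℕ i′ →
           toℕ i + toℕ j + r ≡ toℕ i′ + toℕ j′ + r → toℕ k + s ≡ toℕ k′ + s →
           (i , j , k) ≡ (i′ , j′ , k′)
  -- The first length only determines i + j, so i is identified before j.
  keys-≡ i i′ i≡ r≡ s≡ with Finₚ.toℕ-injective i≡
  ... | refl = cong (i ,_) (cong₂ _,_
    (Finₚ.toℕ-injective (+-cancelˡ-≡ (toℕ i) _ _ (+-cancelʳ-≡ r _ _ r≡)))
    (Finₚ.toℕ-injective (+-cancelʳ-≡ s _ _ s≡)))
  sizes-≤ : ∀ (i j k : Fin e) → a ∸ toℕ i + (toℕ i + (toℕ j + suc r)) + (toℕ k + suc s) ≤ n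
  sizes-≤ i j k = begin
      a ∸ toℕ i + (toℕ i + (toℕ j + suc r)) + (toℕ k + suc s)
        ≡⟨ rearrange (a ∸ toℕ i) (toℕ i) (toℕ j) (toℕ k) r s ⟩
      a ∸ toℕ i + toℕ i + suc r + suc s + (toℕ j + toℕ k)
        ≡⟨ cong (λ a → a + suc r + suc s + (toℕ j + toℕ k)) (m∸n+n≡m (i≤a i)) ⟩
      a + suc r + suc s + (toℕ j + toℕ k)
        ≤⟨ +-monoʳ-≤ (a + suc r + suc s) (+-mono-≤ (<⇒≤ (Finₚ.toℕ<n j)) (<⇒≤ (Finₚ.toℕ<n k))) ⟩
      a + suc r + suc s + (e + e)
        ≤⟨ le ⟩
      n ∎
    where
    open ≤-Reasoning
    rearrange : ∀ b i j k r s → b + (i + (j + suc r)) + (k + suc s) ≡ b + i + suc r + suc s + (j + k)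
    rearrange = solve-∀
  r≡ : ∀ i j r → suc (i + j + r) ≡ i + (j + suc r)
  r≡ = solve-∀
  s≡ : ∀ k s → suc (k + s) ≡ k + suc s
  s≡ = solve-∀
  le′ : ∀ (i j k : Fin e) → a ∸ toℕ i + suc (toℕ i + toℕ j + r) + suc (toℕ k + s) ≤ n
  le′ i j k = subst₂ (λ r s → a ∸ toℕ i + r + s ≤ n)
    (sym (r≡ (toℕ i) (toℕ j) r)) (sym (s≡ (toℕ k) s)) (sizes-≤ i j k)
  ω≤τ : ∀ (i j k : Fin e) {τ} →
        Shape (a ∸ toℕ i) (suc (toℕ i + toℕ j + r)) (suc (toℕ k + s)) τ → ω ≤ᴮ τ
  ω≤τ i j k {τ} τ-shape = family-≤ᴮ (toℕ i) (toℕ j) (toℕ k) (sizes-≤ i j k)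
    (subst (λ b → Shape b (suc r) (suc s) ω) (sym (m+[n∸m]≡n (i≤a i))) ω-shape)
    (subst₂ (λ r s → Shape (a ∸ toℕ i) r s τ) (r≡ (toℕ i) (toℕ j) r) (s≡ (toℕ k) s) τ-shape)

-- Triples near the boundary of the parameter region

Degenerate : ℕ → ℕ → ℕ → ℕ → ℕ → Set
Degenerate n d a r s = a < d ⊎ r < d ⊎ s < d ⊎ n < a + suc r + suc s + d

degenerate-or-wide : ∀ n d a r s →
  Degenerate n d a r s ⊎ (d ≤ a × d ≤ r × d ≤ s × a + suc r + suc s + d ≤ n)
degenerate-or-wide n d a r s with a <? d | r <? d | s <? d | n <? a + suc r + suc s + d
... | yes a<d | _       | _       | _      = inj₁ (inj₁ a<d)
... | no _    | yes r<d | _       | _      = inj₁ (inj₂ (inj₁ r<d))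
... | no _    | no _    | yes s<d | _      = inj₁ (inj₂ (inj₂ (inj₁ s<d)))
... | no _    | no _    | no _    | yes n< = inj₁ (inj₂ (inj₂ (inj₂ n<)))
... | no a≮d  | no r≮d  | no s≮d  | no n≮  = inj₂ (≮⇒≥ a≮d , ≮⇒≥ r≮d , ≮⇒≥ s≮d , ≮⇒≥ n≮)

-- Some coordinate x of a degenerate triple, or its codimension x, is below d, and the other two
-- coordinates y and z determine the triple.
decode : ℕ → Fin 4 → ℕ → ℕ → ℕ → ℕ × ℕ × ℕ
decode n 0F x y z = x , y , z
decode n 1F x y z = y , x , z
decode n 2F x y z = y , z , x
decode n 3F x y z = y , z , n ∸ (y + suc z + suc x)

encode : ∀ {n} d a r s → a + suc r + suc s ≤ n → Degenerate n d a r s →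
         ∃[ c ] ∃[ x ] ∃[ y ] ∃[ z ] (x < d × y < n × z < n × decode n c x y z ≡ (a , r , s))
encode {n} d a r s le degenerate = by-cases degenerate
  where
  a<n : a < n
  a<n = ≤-trans (a<size a r s) le
  r<n : r < n
  r<n = ≤-trans (r<size a r s) le
  s<n : s < n
  s<n = ≤-trans (s<size a r s) le
  by-cases : Degenerate n d a r s →
             ∃[ c ] ∃[ x ] ∃[ y ] ∃[ z ] (x < d × y < n × z < n × decode n c x y z ≡ (a , r , s))
  by-cases (inj₁ a<d)               = 0F , a , r , s , a<d , r<n , s<n , refl
  by-cases (inj₂ (inj₁ r<d))        = 1F , r , a , s , r<d , a<n , s<n , refl
  by-cases (inj₂ (inj₂ (inj₁ s<d))) = 2F , s , a , r , s<d , a<n , r<n , refl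
  by-cases (inj₂ (inj₂ (inj₂ n<)))  with m≤n⇒∃[o]m+o≡n le
  -- The small coordinate is the number t of entries after the blocks. Counting it as suc t takes up
  -- the unit of suc s, so the subtraction in `decode` returns s itself.
  ... | t , refl = 3F , t , a , r , +-cancelˡ-< (a + suc r + suc s) _ _ n< , a<n , r<n
      , cong (λ s → a , r , s) (trans (cong (_∸ (a + suc r + suc t)) (rearrange a r s t)) (m+n∸m≡n (a + suc r + suc t) s))
    where
    rearrange : ∀ a r s t → a + suc r + suc s + t ≡ a + suc r + suc t + s
    rearrange = solve-∀

few-degenerate : ∀ {n} d {xs : List (𝔖 n)} → Unique.Unique (𝔖-setoid n) xs →
  (∀ {ω} → ω ∈ xs → ∃[ a ] ∃[ r ] ∃[ s ]
     (a + suc r + suc s ≤ n × Shape a (suc r) (suc s) ω × Degenerate n d a r s)) →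
  length xs ≤ 4 * (d * (n * n))
few-degenerate {n} d {xs} unique degenerate = length-≤-keys keys R unique key shape-≈
  where
  keys : Fin (4 * (d * (n * n))) ↔ (Fin 4 × Fin d × Fin n × Fin n)
  keys = (↔-id (Fin 4) ×-↔ Fin*³↔ d n n) ↔-∘ Finₚ.*↔×
  Coded : ℕ × ℕ × ℕ → 𝔖 n → Set
  Coded t ω = Shape (proj₁ t) (suc (proj₁ (proj₂ t))) (suc (proj₂ (proj₂ t))) ω
  R : Fin 4 × Fin d × Fin n × Fin n → 𝔖 n → Set
  R (c , x , y , z) ω = Coded (decode n c (toℕ x) (toℕ y) (toℕ z)) ω
  key : ∀ {ω} → ω ∈ xs → ∃[ k ] R k ω
  key {ω} ω∈ with degenerate ω∈
  ... | a , r , s , le , ω-shape , deg with encode d a r s le deg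
  ... | c , x , y , z , x<d , y<n , z<n , eq = (c , fromℕ< x<d , fromℕ< y<n , fromℕ< z<n) , coded
    where
    coded : Coded (decode n c (toℕ (fromℕ< x<d)) (toℕ (fromℕ< y<n)) (toℕ (fromℕ< z<n))) ω
    coded rewrite Finₚ.toℕ-fromℕ< x<d | Finₚ.toℕ-fromℕ< y<n | Finₚ.toℕ-fromℕ< z<n | eq = ω-shape

-- Typical and atypical permutations

n^3≡cube : ∀ n → n ^ 3 ≡ cube n
n^3≡cube n = cong (λ m → n * (n * m)) (*-identityʳ n)

-- The decidable substitute for the event, with K in the role of h n. The upper bounds hold for
-- every ω, by `α≤n³` and `β≤n³`.
Typical : ∀ {n} → ℕ → 𝔖 n → Set
Typical {n} K ω = cube n ≤ K * α ω × cube n ≤ K * β ω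

typical? : ∀ {n} K → Decidable (Typical {n} K)
typical? {n} K ω = (cube n ≤? K * α ω) ×-dec (cube n ≤? K * β ω)

wide⇒typical : ∀ {n e K} a r s (ω : 𝔖 n) → cube n ≤ K * cube e → Shape a (suc r) (suc s) ω →
               e + e ≤ a → e + e ≤ r → e + e ≤ s → a + suc r + suc s + (e + e) ≤ n → Typical K ω
wide⇒typical {n} {e} {K} a r s ω n³≤Ke³ ω-shape 2e≤a 2e≤r 2e≤s le =
    ≤-trans n³≤Ke³ (*-monoʳ-≤ K (e³≤α e a r s {ω} le ω-shape (m+n≤o⇒m≤o e 2e≤a)))
  , ≤-trans n³≤Ke³ (*-monoʳ-≤ K (e³≤β e a r s {ω} (m+n≤o⇒m≤o _ le) ω-shape 2e≤r 2e≤s))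

atypical⇒degenerate : ∀ {n e K} {ω : 𝔖 n} → cube n ≤ K * cube e → ¬ Typical K ω →
  ∃[ a ] ∃[ r ] ∃[ s ] (a + suc r + suc s ≤ n × Shape a (suc r) (suc s) ω) →
  ∃[ a ] ∃[ r ] ∃[ s ] (a + suc r + suc s ≤ n × Shape a (suc r) (suc s) ω × Degenerate n (e + e) a r s)
atypical⇒degenerate {n} {e} {K} {ω} n³≤Ke³ atypical (a , r , s , le , ω-shape) =
    a , r , s , le , ω-shape , [ id , (λ { (2e≤a , 2e≤r , 2e≤s , le′) →
      ⊥-elim (atypical (wide⇒typical {n} {e} {K} a r s ω n³≤Ke³ ω-shape 2e≤a 2e≤r 2e≤s le′)) }) ]′
      (degenerate-or-wide n (e + e) a r s)

atypicals : ∀ n → ℕ → List (𝔖 n)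
atypicals n K = filter (∁? (typical? K)) (𝔅 n)

∣atypicals∣≤ : ∀ n e K → cube n ≤ K * cube e → length (atypicals n K) ≤ 4 * ((e + e) * (n * n))
∣atypicals∣≤ n e K n³≤Ke³ = few-degenerate (e + e) {atypicals n K}
    (UniqueSetoidₚ.filter⁺ (𝔖-setoid n) (∁? (typical? K)) (𝔅-unique n))
    (λ {ω} ω∈ → let ω∈𝔅 , atypical = ∈-filter⁻ (∁? (typical? K)) {xs = 𝔅 n} ω∈
               in atypical⇒degenerate {n} {e} {K} {ω} n³≤Ke³ atypical (∈𝔅⇒shape ω∈𝔅))

length-filter-∁ : ∀ {A : Set} {P : Pred A 0ℓ} (P? : Decidable P) xs →
                  length xs ≡ length (filter P? xs) + length (filter (∁? P?) xs)
length-filter-∁ P? [] = refl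
length-filter-∁ P? (x ∷ xs) with does (P? x)
... | true  = cong suc (length-filter-∁ P? xs)
... | false = trans (cong suc (length-filter-∁ P? xs)) (sym (+-suc _ _))

α≤n³ : ∀ {n} (ω : 𝔖 n) → α ω ≤ n ^ 3
α≤n³ {n} ω = ≤-trans (length-filter (ω ≤ᴮ?_) (𝔅 n)) (≤-trans (∣𝔅∣≤n³ n) (≤-reflexive (sym (n^3≡cube n))))

β≤n³ : ∀ {n} (ω : 𝔖 n) → β ω ≤ n ^ 3
β≤n³ {n} ω = ≤-trans (length-filter (_≤ᴮ? ω) (𝔅 n)) (≤-trans (∣𝔅∣≤n³ n) (≤-reflexive (sym (n^3≡cube n))))

-- Choice of the constants

n≤2Q[n/Q] : ∀ n Q .{{_ : NonZero Q}} → Q ≤ n → n ≤ (2 * Q) * (n / Q)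
n≤2Q[n/Q] n Q Q≤n = begin
    n                          ≡⟨ m≡m%n+[m/n]*n n Q ⟩
    n % Q + (n / Q) * Q        ≤⟨ +-monoˡ-≤ _ (<⇒≤ (m%n<n n Q)) ⟩
    Q + (n / Q) * Q            ≡⟨ cong (_+ (n / Q) * Q) (sym (*-identityˡ Q)) ⟩
    -- As n / Q is at least 1, doubling (n / Q) * Q absorbs the remainder.
    1 * Q + (n / Q) * Q        ≤⟨ +-monoˡ-≤ _ (*-monoˡ-≤ Q (m≥n⇒m/n>0 Q≤n)) ⟩
    (n / Q) * Q + (n / Q) * Q  ≡⟨ rearrange (n / Q) Q ⟩
    (2 * Q) * (n / Q)          ∎
  where
  open ≤-Reasoning
  rearrange : ∀ e Q → e * Q + e * Q ≡ (2 * Q) * e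
  rearrange = solve-∀

cube-≤ : ∀ {n q e} → n ≤ q * e → cube n ≤ cube q * cube e
cube-≤ {n} {q} {e} n≤qe = ≤-trans (*-mono-≤ n≤qe (*-mono-≤ n≤qe n≤qe)) (≤-reflexive (rearrange q e))
  where
  rearrange : ∀ q e → (q * e) * ((q * e) * (q * e)) ≡ (q * (q * q)) * (e * (e * e))
  rearrange = solve-∀

-- The choice m = n / 3 in `m³≤∣𝔅∣`; rounding costs a factor 2, whence the constant (2 · 3)³.
n³≤c∣𝔅∣ : ∀ n → 3 ≤ n → cube n ≤ cube (2 * 3) * length (𝔅 n)
n³≤c∣𝔅∣ n 3≤n = ≤-trans (cube-≤ {n} {2 * 3} {n / 3} (n≤2Q[n/Q] n 3 3≤n))
  (*-monoʳ-≤ (cube (2 * 3)) (m³≤∣𝔅∣ (n / 3) n (≤-trans (≤-reflexive (*-comm 3 (n / 3))) (m/n*n≤m n 3))))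

-- Here b counts the exceptions and B all elements: c k b ≤ 8 c k e n² ≤ n³ ≤ c B, and c cancels.
density-bound : ∀ c k e n b B .{{_ : NonZero c}} → b ≤ 4 * ((e + e) * (n * n)) →
                 e * (c * (8 * k)) ≤ n → cube n ≤ c * B → k * b ≤ B
density-bound c k e n b B b≤ e≤ n³≤ = *-cancelˡ-≤ c (begin
    c * (k * b)                          ≤⟨ *-monoʳ-≤ c (*-monoʳ-≤ k b≤) ⟩
    c * (k * (4 * ((e + e) * (n * n))))  ≡⟨ rearrange c k e n ⟩
    e * (c * (8 * k)) * (n * n)          ≤⟨ *-monoˡ-≤ (n * n) e≤ ⟩
    n * (n * n)                          ≤⟨ n³≤ ⟩
    c * B                                ∎)
  where
  open ≤-Reasoning
  rearrange : ∀ c k e n → c * (k * (4 * ((e + e) * (n * n)))) ≡ e * (c * (8 * k)) * (n * n)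
  rearrange = solve-∀

-- The factor c (8 k) of `density-bound` for c = 6³ and suc k in place of k. Dividing n by it gives
-- e, and e is positive once n reaches it.
threshold : ℕ → ℕ
threshold k = cube (2 * 3) * (8 * suc k)

instance
  threshold-nonZero : ∀ {k} → NonZero (threshold k)
  threshold-nonZero {k} = m*n≢0 (cube (2 * 3)) (8 * suc k) {{_}} {{m*n≢0 8 (suc k)}}

-- The two extra units only serve to make the bound exceed 1.
ratio : ℕ → ℕ
ratio k = suc (suc (cube (2 * threshold k)))

atypical-≤ : ∀ k n → threshold k ≤ n → suc k * length (atypicals n (ratio k)) ≤ length (𝔅 n)
atypical-≤ k n Q≤n = density-bound (cube (2 * 3)) (suc k) e n _ _
    (∣atypicals∣≤ n e (ratio k) n³≤) (m/n*n≤m n (threshold k)) (n³≤c∣𝔅∣ n (≤-trans 3≤Q Q≤n))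
  where
  e = n / threshold k
  n³≤ : cube n ≤ ratio k * cube e
  n³≤ = ≤-trans (cube-≤ {n} {2 * threshold k} {e} (n≤2Q[n/Q] n (threshold k) Q≤n))
    (*-monoˡ-≤ (cube e) {cube (2 * threshold k)} (m≤n+m _ 2))
  3≤Q : 3 ≤ threshold k
  3≤Q = ≤-trans (≤ᵇ⇒≤ 3 (cube (2 * 3)) _) (m≤m*n (cube (2 * 3)) (8 * suc k) {{m*n≢0 8 (suc k)}})

-- Rational and real estimates

fromℕ-mono-≤ : ∀ {m n} → m ≤ n → fromℕ m ℚ.≤ fromℕ n
fromℕ-mono-≤ m≤n = *≤* (ℤₚ.*-monoʳ-≤-nonNeg (ℤ.+ 1) (ℤ.+≤+ m≤n))

fromℕ-mono-< : ∀ {m n} → m < n → fromℕ m ℚ.< fromℕ n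
fromℕ-mono-< m<n = *<* (ℤₚ.*-monoʳ-<-pos (ℤ.+ 1) (ℤ.+<+ m<n))

fromℕ-* : ∀ m n → fromℕ (m * n) ≡ fromℕ m ℚ.* fromℕ n
fromℕ-* m n = ℚₚ.toℚᵘ-injective (ℚᵘₚ.≃-trans
  (ℚᵘ.*≡* (cong (ℤ._* ℤ.+ 1) (ℤₚ.pos-* m n))) (ℚᵘₚ.≃-sym (ℚₚ.toℚᵘ-homo-* (fromℕ m) (fromℕ n))))

fromℕ-+ : ∀ m n → fromℕ (m + n) ≡ fromℕ m ℚ.+ fromℕ n
fromℕ-+ m n = ℚₚ.toℚᵘ-injective (ℚᵘₚ.≃-trans
  (ℚᵘ.*≡* (cong (ℤ._* ℤ.+ 1) (sym (cong₂ ℤ._+_ (ℤₚ.*-identityʳ (ℤ.+ m)) (ℤₚ.*-identityʳ (ℤ.+ n))))))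
  (ℚᵘₚ.≃-sym (ℚₚ.toℚᵘ-homo-+ (fromℕ m) (fromℕ n))))

archimedean : ∀ ε → 0ℚ ℚ.< ε → ∃[ k ] 1ℚ ℚ.≤ fromℕ (suc k) ℚ.* ε
archimedean (mkℚ (ℤ.+ 0) d-1 _) (*<* (ℤ.+<+ ()))
archimedean (mkℚ -[1+ _ ] d-1 _) (*<* ())
-- For ε = (m + 1) / d the multiplier d = suc d-1 works, since d ε = m + 1 ≥ 1.
archimedean ε@(mkℚ +[1+ m ] d-1 _) 0<ε = d-1 ,
  ℚₚ.toℚᵘ-cancel-≤ (ℚᵘₚ.≤-respʳ-≃ (ℚᵘₚ.≃-sym (ℚₚ.toℚᵘ-homo-* (fromℕ (suc d-1)) ε))
    (ℚᵘ.*≤* (ℤ.+≤+ (subst₂ _≤_ lhs rhs (m≤m*n (suc d-1) (suc m))))))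
  where
  lhs : suc d-1 ≡ _
  lhs = sym (trans (+-identityʳ _) (+-identityʳ _))
  rhs : suc d-1 * suc m ≡ _
  rhs = sym (*-identityʳ _)

module _ {x : ℝ} (x>0 : IsPositive x) {K : ℕ} (K≤x : ℕ→ℝ (suc (suc K)) ≤ᴿ x) where

  private
    instance
      fromℕ-nonNegative : ∀ {n} → ℚ.NonNegative (fromℕ n)
      fromℕ-nonNegative {n} = ℚ.nonNegative (fromℕ-mono-≤ {0} {n} z≤n)

  -- The lower cut of a multiple of x asks for a rational strictly below x, and 1 is one because x ≥
  -- K + 2.
  ≤-scaled : ∀ {N c} → c ≤ N → ℕ→ℝ c ≤ᴿ x · N
  ≤-scaled {N} {c} c≤N q<c = 1ℚ , K≤x (fromℕ-mono-< {1} {suc (suc K)} (s≤s (s≤s z≤n)))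
    , ℚₚ.<-≤-trans q<c (ℚₚ.≤-trans (fromℕ-mono-≤ c≤N) (ℚₚ.≤-reflexive (sym (ℚₚ.*-identityˡ (fromℕ N)))))

  -- Put M = K + 2. A rational r below 1 / x has r u < 1 for some u > x ≥ M. If r ≥ 0, then r M ≤ 1
  -- and r N ≤ r M c ≤ c; if r < 0, then r N ≤ 0 ≤ c.
  scaled-≤ : ∀ {N c} → N ≤ suc (suc K) * c → N /[ x , x>0 ] ≤ᴿ ℕ→ℝ c
  scaled-≤ {N} {c} N≤Kc {q} (r , (u , x<u , ru<1) , q<rN) with 0ℚ ℚₚ.≤? r
  ... | no 0≰r = ℚₚ.<-≤-trans q<rN (begin
      r ℚ.* fromℕ N   ≤⟨ ℚₚ.*-monoʳ-≤-nonNeg (fromℕ N) (ℚₚ.<⇒≤ (ℚₚ.≰⇒> 0≰r)) ⟩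
      0ℚ ℚ.* fromℕ N  ≡⟨ ℚₚ.*-zeroˡ (fromℕ N) ⟩
      0ℚ              ≤⟨ fromℕ-mono-≤ {0} {c} z≤n ⟩
      fromℕ c         ∎)
    where open ℚₚ.≤-Reasoning
  ... | yes 0≤r = ℚₚ.<-≤-trans q<rN (begin
      r ℚ.* fromℕ N                ≤⟨ ℚₚ.*-monoˡ-≤-nonNeg r {{ℚ.nonNegative 0≤r}} (fromℕ-mono-≤ N≤Kc) ⟩
      r ℚ.* fromℕ (M * c)          ≡⟨ cong (r ℚ.*_) (fromℕ-* M c) ⟩
      r ℚ.* (fromℕ M ℚ.* fromℕ c)  ≡⟨ ℚₚ.*-assoc r (fromℕ M) (fromℕ c) ⟨
      r ℚ.* fromℕ M ℚ.* fromℕ c    ≤⟨ ℚₚ.*-monoʳ-≤-nonNeg (fromℕ c) rM≤1 ⟩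
      1ℚ ℚ.* fromℕ c               ≡⟨ ℚₚ.*-identityˡ (fromℕ c) ⟩
      fromℕ c                      ∎)
    where
    open ℚₚ.≤-Reasoning
    M = suc (suc K)
    M≤u : fromℕ M ℚ.≤ u
    M≤u = ℚₚ.≮⇒≥ λ u<M → disjoint x (K≤x u<M) x<u
    rM≤1 : r ℚ.* fromℕ M ℚ.≤ 1ℚ
    rM≤1 = ℚₚ.≤-trans (ℚₚ.*-monoˡ-≤-nonNeg r {{ℚ.nonNegative 0≤r}} M≤u) (ℚₚ.<⇒≤ ru<1)

-- With B = g + b, the chain b ≤ (k + 1) ε b ≤ ε B gives g = B - b ≥ (1 - ε) B.
complement-≤ : ∀ {ε k} g b → 1ℚ ℚ.≤ fromℕ (suc k) ℚ.* ε → suc k * b ≤ g + b → 0ℚ ℚ.< ε →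
               (1ℚ ℚ.- ε) ℚ.* fromℕ (g + b) ℚ.≤ fromℕ g
complement-≤ {ε} {k} g b 1≤kε kb≤B 0<ε = begin
    (1ℚ ℚ.- ε) ℚ.* fromℕ B                ≡⟨ ℚₚ.*-distribʳ-+ (fromℕ B) 1ℚ (ℚ.- ε) ⟩
    1ℚ ℚ.* fromℕ B ℚ.+ ℚ.- ε ℚ.* fromℕ B  ≡⟨ cong₂ ℚ._+_ (ℚₚ.*-identityˡ (fromℕ B)) (sym (ℚₚ.neg-distribˡ-* ε (fromℕ B))) ⟩
    fromℕ B ℚ.- ε ℚ.* fromℕ B             ≤⟨ ℚₚ.+-monoʳ-≤ (fromℕ B) (ℚₚ.neg-antimono-≤ b≤εB) ⟩
    fromℕ B ℚ.- fromℕ b                   ≡⟨ cong (ℚ._- fromℕ b) (fromℕ-+ g b) ⟩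
    fromℕ g ℚ.+ fromℕ b ℚ.- fromℕ b       ≡⟨ ℚₚ.+-assoc (fromℕ g) (fromℕ b) (ℚ.- fromℕ b) ⟩
    fromℕ g ℚ.+ (fromℕ b ℚ.- fromℕ b)     ≡⟨ cong (fromℕ g ℚ.+_) (ℚₚ.+-inverseʳ (fromℕ b)) ⟩
    fromℕ g ℚ.+ 0ℚ                        ≡⟨ ℚₚ.+-identityʳ (fromℕ g) ⟩
    fromℕ g                               ∎
  where
  open ℚₚ.≤-Reasoning
  B = g + b
  b≤εB : fromℕ b ℚ.≤ ε ℚ.* fromℕ B
  b≤εB = begin
      fromℕ b                            ≡⟨ ℚₚ.*-identityˡ (fromℕ b) ⟨
      1ℚ ℚ.* fromℕ b                     ≤⟨ ℚₚ.*-monoʳ-≤-nonNeg (fromℕ b) {{ℚ.nonNegative (fromℕ-mono-≤ {0} {b} z≤n)}} 1≤kε ⟩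
      fromℕ (suc k) ℚ.* ε ℚ.* fromℕ b    ≡⟨ cong (ℚ._* fromℕ b) (ℚₚ.*-comm (fromℕ (suc k)) ε) ⟩
      ε ℚ.* fromℕ (suc k) ℚ.* fromℕ b    ≡⟨ ℚₚ.*-assoc ε (fromℕ (suc k)) (fromℕ b) ⟩
      ε ℚ.* (fromℕ (suc k) ℚ.* fromℕ b)  ≡⟨ cong (ε ℚ.*_) (fromℕ-* (suc k) b) ⟨
      ε ℚ.* fromℕ (suc k * b)            ≤⟨ ℚₚ.*-monoˡ-≤-nonNeg ε {{ℚ.nonNegative (ℚₚ.<⇒≤ 0<ε)}} (fromℕ-mono-≤ kb≤B) ⟩
      ε ℚ.* fromℕ B                      ∎

-- From typical permutations to the probability bound

Bounded : (h : ℕ → ℝ) → (∀ n → IsPositive (h n)) → ∀ n → 𝔖 n → Set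
Bounded h h>0 n ω =
  ((n ^ 3) /[ h n , h>0 n ] ≤ᴿ ℕ→ℝ (α ω) × ℕ→ℝ (α ω) ≤ᴿ h n · (n ^ 3)) ×
  ((n ^ 3) /[ h n , h>0 n ] ≤ᴿ ℕ→ℝ (β ω) × ℕ→ℝ (β ω) ≤ᴿ h n · (n ^ 3))

typical⇒bounded : ∀ h h>0 n K (ω : 𝔖 n) → ℕ→ℝ (suc (suc K)) ≤ᴿ h n →
                  Typical (suc (suc K)) ω → Bounded h h>0 n ω
typical⇒bounded h h>0 n K ω K≤h (n³≤Kα , n³≤Kβ) =
    (scaled-≤ {h n} (h>0 n) {K} K≤h {c = α ω} (≤-trans (≤-reflexive (n^3≡cube n)) n³≤Kα) ,
     ≤-scaled {h n} (h>0 n) {K} K≤h {c = α ω} (α≤n³ ω))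
  , (scaled-≤ {h n} (h>0 n) {K} K≤h {c = β ω} (≤-trans (≤-reflexive (n^3≡cube n)) n³≤Kβ) ,
     ≤-scaled {h n} (h>0 n) {K} K≤h {c = β ω} (β≤n³ ω))

typical-≤ℙ : ∀ {ε k n} → 0ℚ ℚ.< ε → 1ℚ ℚ.≤ fromℕ (suc k) ℚ.* ε → threshold k ≤ n →
             (1ℚ ℚ.- ε) ≤ℙ Typical {n} (ratio k)
typical-≤ℙ {ε} {k} {n} 0<ε 1≤kε Q≤n =
    typicals , filter-⊆ (typical? (ratio k)) (𝔅 n) , Allₚ.all-filter (typical? (ratio k)) (𝔅 n)
  , subst (λ B → (1ℚ ℚ.- ε) ℚ.* fromℕ B ℚ.≤ fromℕ (length typicals)) (sym ∣𝔅∣≡)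
      (complement-≤ {ε} {k} (length typicals) (length (atypicals n (ratio k))) 1≤kε
        (subst (suc k * length (atypicals n (ratio k)) ≤_) ∣𝔅∣≡ (atypical-≤ k n Q≤n)) 0<ε)
  where
  typicals = filter (typical? (ratio k)) (𝔅 n)
  ∣𝔅∣≡ = length-filter-∁ (typical? (ratio k)) (𝔅 n)

≤ℙ-mono : ∀ {n q} {E F : 𝔖 n → Set} → (∀ ω → E ω → F ω) → q ≤ℙ E → q ≤ℙ F
≤ℙ-mono E⇒F (ωs , ωs⊆𝔅 , all-E , q≤) = ωs , ωs⊆𝔅 , All.map (E⇒F _) all-E , q≤

theorem4p6 : (h : ℕ → ℝ) (h>0 : ∀ n → IsPositive (h n)) → Tends-to-∞ h →
    With-high-probability (λ n ω →
    ((n ^ 3) /[ h n , h>0 n ] ≤ᴿ ℕ→ℝ (α ω) × ℕ→ℝ (α ω) ≤ᴿ h n · (n ^ 3)) ×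
    ((n ^ 3) /[ h n , h>0 n ] ≤ᴿ ℕ→ℝ (β ω) × ℕ→ℝ (β ω) ≤ᴿ h n · (n ^ 3)))
theorem4p6 h h>0 h→∞ ε 0<ε =
  let k , 1≤kε = archimedean ε 0<ε
      N , ratio≤h = h→∞ (ℕ→ℝ (ratio k))
  -- Beyond `threshold k` the atypical permutations are a proportion at most ε; beyond N, h n is at
  -- least `ratio k`.
  in threshold k ⊔ N , λ n N′≤n → ≤ℙ-mono {n} {1ℚ ℚ.- ε} {Typical (ratio k)} {Bounded h h>0 n}
       (λ ω → typical⇒bounded h h>0 n _ ω (ratio≤h n (m⊔n≤o⇒n≤o (threshold k) N N′≤n)))
       (typical-≤ℙ {ε} {k} {n} 0<ε 1≤kε (m⊔n≤o⇒m≤o (threshold k) N N′≤n))
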